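{- Let $p$ be a prime with $p\equiv5\pmod 6$ and Legendre symbol $\left(\frac{ -3}{p}\right)=-1$, and let $\alpha\ge0$, $n\ge0$ be integers. Then for every integer $i$ with $1\le i\le p-1$, $$\overline{S}_3\big(36p^{2\alpha+2}n+6(6i+p)p^{2\alpha+1}\big)\equiv0\pmod{12}.$$
   Context: For $|q|<1$ and a positive integer $k$, write $f_k=\prod_{j\ge1}(1-q^{kj})$. The function $\overline{S}_3(n)$ (number of $3$-Schur overpartitions of $n$) is defined by $\sum_{n\ge0}\overline{S}_3(n)q^n=\prod_{n\ge1}\frac{(1+q^{2n-1})(1-q^{3(2n-1)})}{(1+q^{3(2n-1)})(1-q^{2n-1})}=\frac{f_2^3f_3^2f_{12}}{f_1^2f_4f_6^3}$. -}

module Defs where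

open import Data.Nat as ℕ using (ℕ; zero; suc; _∸_; _%_; _/_)
open import Data.Integer as ℤ using (ℤ; +_; -_; -1ℤ; 0ℤ; 1ℤ)
open import Data.Nat.Primality using (Prime)
open import Data.Nat.Divisibility using (_∣_)
open import Data.Product using (∃)
open import Relation.Binary.PropositionalEquality using (_≡_)
open import Relation.Nullary using (¬_; yes; no)

-- Formal power series in q with integer coefficients: n ↦ coefficient of q^n.
Series : Set
Series = ℕ → ℤ

sumTo : ℕ → (ℕ → ℤ) → ℤ
sumTo zero    f = f 0
sumTo (suc n) f = sumTo n f ℤ.+ f (suc n)

_⊛_ : Series → Series → Series
(a ⊛ b) n = sumTo n (λ k → a k ℤ.* b (n ∸ k))

one : Series
one zero    = 1ℤ
one (suc _) = 0ℤ

binom : ℤ → ℕ → Series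
binom c d zero = 1ℤ
binom c d (suc n) with n ℕ.≟ d
... | yes _ = c
... | no  _ = 0ℤ

-- 1 / (1 - c q^(suc d)) = Σ_{k≥0} c^k q^{(suc d) k}   (c = ±1)
geom : ℤ → ℕ → Series
geom c d n with n % suc d ℕ.≟ 0
... | yes _ = c ℤ.^ (n / suc d)
... | no  _ = 0ℤ

-- The factor for the odd number m = 2j+1:
--   (1 + q^m)(1 - q^{3m}) / ((1 + q^{3m})(1 - q^m))
-- Here m = suc (2j) and 3m = suc (2 + 6j).
factor : ℕ → Series
factor j =
  binom 1ℤ (2 ℕ.* j) ⊛ (binom -1ℤ (2 ℕ.+ 6 ℕ.* j)
    ⊛ (geom -1ℤ (2 ℕ.+ 6 ℕ.* j) ⊛ geom 1ℤ (2 ℕ.* j)))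

partialProd : ℕ → Series
partialProd zero    = one
partialProd (suc N) = partialProd N ⊛ factor N

-- S̄₃(n): coefficient of q^n in ∏_{n≥1} (1+q^{2n-1})(1-q^{3(2n-1)}) / ((1+q^{3(2n-1)})(1-q^{2n-1})).
-- Factors with odd m > n are ≡ 1 mod q^{n+1}, so the product over m ≤ 2n+1 suffices.
S3bar : ℕ → ℤ
S3bar n = partialProd (suc n) n

-- Legendre symbol (-3 / p) = -1 for a prime p ≠ 3: -3 is not a square modulo p.
LegendreMinus3IsMinus1 : ℕ → Set
LegendreMinus3IsMinus1 p = ¬ ∃ λ x → p ∣ x ℕ.* x ℕ.+ 3

{-# OPTIONS --safe #-}

-- Write n = 6K for the argument of S3bar; K is odd, and neither K nor 3K is a square, because
-- the exponent of p in both is odd.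
--
-- Modulo 4 the factor (1 + x)(1 - x³) / ((1 + x³)(1 - x)) is 1 + 2 (1/(1 - x) + 1/(1 + x³)), so S3bar n
-- is twice the number of odd m with m ∣ n plus the number of odd m with 3m ∣ n.  These numbers
-- are d(3K) and d(K), both even for non-squares.
--
-- Modulo 3 the coefficient of q^n vanishes for every n ≡ 6 (mod 12).  There 1 ± x³ ≡ (1 ± x)³, so the
-- product P is Φ(-q)/Φ(q) with Φ(q) = Σ q^(k²), k ∈ ℤ, by Gauss's product formula.  Splitting k by parity,
-- Φ(±q) = u ± q v with u = Φ(q⁴) and v = Σ q^(4k(k+1)), whence
--   P = (u - q v)² (u² + q² v²) / (u⁴ - q⁴ v⁴).
-- By Jacobi's identity the denominator is Φ(-q⁴)⁴, and the only part of P with exponents ≡ 2 (mod 4) is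
-- 2 q² u² v² / Φ(-q⁴)⁴ = 8 q² Π (1 - q^(4(2j+1)))^(-12) ≡ 8 q² Π (1 - q^(12(2j+1)))^(-4) (mod 3),
-- whose exponents are ≡ 2 (mod 12).
--
-- Everything happens in the ring of series modulo q^N, where q is nilpotent and the infinite
-- products and sums are finite.

module Submission where

open import Defs
open import Algebra.Bundles using (CommutativeRing)
open import Algebra.Solver.Ring.AlmostCommutativeRing using (fromCommutativeRing; _-Raw-AlmostCommutative⟶_)
import Algebra.Solver.Ring as RingSolver
import Algebra.Properties.AbelianGroup as AbelianGroupProperties
import Algebra.Properties.CommutativeSemigroup as CommutativeSemigroupProperties
import Algebra.Properties.CommutativeSemiring.Exp as CommutativeExponentiation
import Algebra.Properties.Ring as RingProperties
import Algebra.Properties.Semiring.Exp as Exponentiation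
import Algebra.Properties.Semiring.Mult.TCOptimised as Multiples
import Relation.Binary.Reasoning.Setoid as SetoidReasoning
open import Data.Nat as ℕ using (ℕ; zero; suc; _∸_; _<_; _≤_; z≤n; s≤s; _%_; _/_)
import Data.Nat.Divisibility as ℕ∣
import Data.Nat.DivMod as DivMod
import Data.Nat.Properties as ℕₚ
import Data.Nat.Tactic.RingSolver as ℕSolver
open import Data.Nat.Primality using (Prime; prime[2]; prime?; euclidsLemma; prime⇒nonZero; prime⇒irreducible; ¬prime[1])
open import Data.Nat.Solver using (module +-*-Solver)
open import Data.Integer as ℤ using (ℤ; +_; -[1+_]; 0ℤ; 1ℤ; -1ℤ)
import Data.Integer.Properties as ℤₚ
import Data.Integer.Tactic.RingSolver as ℤSolver
open import Data.Integer.Divisibility.Signed using (divides; ∣m∣n⇒∣m+n; ∣m∣n⇒∣m-n; ∣m⇒∣-m; ∣n⇒∣m*n; ∣m⇒∣m*n; ∣ᵤ⇒∣; ∣⇒∣ᵤ; *-monoʳ-∣) renaming (_∣_ to _∣ₛ_)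
open import Data.Empty using (⊥-elim)
open import Data.Maybe using (Maybe; just; nothing)
open import Data.Product using (_,_; ∃)
open import Data.Sum using (_⊎_; inj₁; inj₂; [_,_]′)
open import Function using (_∘_; id)
open import Level using (_⊔_)
open import Relation.Nullary using (¬_; Dec; yes; no)
open import Relation.Nullary.Decidable using (from-no; from-yes)
import Relation.Binary.PropositionalEquality as ≡
open ≡ using (_≡_; _≢_)

-- Ring solver with integer coefficients

-- Gauss's formulas are obtained without a limit. The terms of a bilateral sum over j = k - n are
-- weighted by 1 / ((1 - y) ... (1 - y^k)), with y = q². At n = 0 the weighted sum is Euler's
-- expansion of an infinite product, and each shift of the centre n multiplies it by one further
-- factor. Once n ≥ 2 N, every surviving term has k ≥ N, where the weight is one and the same
-- constant, and the triple product remains.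
--
-- Jacobi's identity needs u² + q² v² = Φ(q²)², which is Φ(x) Φ(-x) = Φ(-x²)² at x = i q. Modulo 3
-- there is no i, so the sign is changed on coefficients instead: both sides of the identity for x =
-- q have the form a + q² b with a and b series in q⁴, and the two parts are told apart by their
-- exponents.
--
-- Reciprocals occur only through equations: a geometric series is a solution of g = 1 + X g, and
-- cancellation uses an explicit inverse supplied by Euler's identity `ABC≈1`.

module IntegerCoefficients {c ℓ} (R : CommutativeRing c ℓ) where
  open CommutativeRing R
  open Multiples semiring using (_×_; 1+×; ×-homo-+; ×1-homo-*)
  open RingProperties ring using (-‿distribˡ-*; -‿distribʳ-*; -0#≈0#; -‿involutive)
  open AbelianGroupProperties +-abelianGroup using (⁻¹-∙-comm)
  open CommutativeSemigroupProperties +-commutativeSemigroup using (interchange)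
  open SetoidReasoning setoid

  -- The optimised multiples let `fromℕ 1` reduce to `1#`, so that `con (+ 1)` in a solver equation
  -- matches `1#` in a goal by computation.
  fromℕ : ℕ → Carrier
  fromℕ n = n × 1#

  fromℤ : ℤ → Carrier
  fromℤ (+ n)    = fromℕ n
  fromℤ -[1+ n ] = - fromℕ (suc n)

  fromℤ-neg : ∀ i → fromℤ (ℤ.- i) ≈ - fromℤ i
  fromℤ-neg (+ zero)  = sym -0#≈0#
  fromℤ-neg (+ suc n) = refl
  fromℤ-neg -[1+ n ]  = sym (-‿involutive _)

  fromℤ-⊖ : ∀ m n → fromℤ (m ℤ.⊖ n) ≈ fromℕ m - fromℕ n
  fromℤ-⊖ m       zero    = sym (trans (+-congˡ -0#≈0#) (+-identityʳ _))
  fromℤ-⊖ zero    (suc n) = sym (+-identityˡ _)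
  fromℤ-⊖ (suc m) (suc n) = begin
    fromℤ (suc m ℤ.⊖ suc n)                  ≡⟨ ≡.cong fromℤ (ℤₚ.[1+m]⊖[1+n]≡m⊖n m n) ⟩
    fromℤ (m ℤ.⊖ n)                          ≈⟨ fromℤ-⊖ m n ⟩
    fromℕ m - fromℕ n                        ≈⟨ +-identityˡ _ ⟨
    0# + (fromℕ m - fromℕ n)                 ≈⟨ +-congʳ (-‿inverseʳ 1#) ⟨
    (1# - 1#) + (fromℕ m - fromℕ n)          ≈⟨ interchange 1# (- 1#) (fromℕ m) (- fromℕ n) ⟩
    (1# + fromℕ m) + (- 1# - fromℕ n)        ≈⟨ +-congˡ (⁻¹-∙-comm 1# (fromℕ n)) ⟩
    (1# + fromℕ m) - (1# + fromℕ n)          ≈⟨ +-cong (1+× m 1#) (-‿cong (1+× n 1#)) ⟨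
    fromℕ (suc m) - fromℕ (suc n)            ∎

  fromℤ-+ : ∀ i j → fromℤ (i ℤ.+ j) ≈ fromℤ i + fromℤ j
  fromℤ-+ (+ m)    (+ n)    = ×-homo-+ 1# m n
  fromℤ-+ (+ m)    -[1+ n ] = fromℤ-⊖ m (suc n)
  fromℤ-+ -[1+ m ] (+ n)    = trans (fromℤ-⊖ n (suc m)) (+-comm _ _)
  fromℤ-+ -[1+ m ] -[1+ n ] = begin
    - fromℕ (suc (suc (m ℕ.+ n)))       ≡⟨ ≡.cong (λ k → - fromℕ (suc k)) (≡.sym (ℕₚ.+-suc m n)) ⟩
    - fromℕ (suc m ℕ.+ suc n)           ≈⟨ -‿cong (×-homo-+ 1# (suc m) (suc n)) ⟩
    - (fromℕ (suc m) + fromℕ (suc n))   ≈⟨ ⁻¹-∙-comm _ _ ⟨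
    - fromℕ (suc m) - fromℕ (suc n)     ∎

  fromℤ-pos* : ∀ m j → fromℤ (+ m ℤ.* j) ≈ fromℕ m * fromℤ j
  fromℤ-pos* m (+ n)    = trans (reflexive (≡.cong fromℤ (≡.sym (ℤₚ.pos-* m n)))) (×1-homo-* m n)
  fromℤ-pos* m -[1+ n ] = begin
    fromℤ (+ m ℤ.* -[1+ n ])            ≡⟨ ≡.cong fromℤ (≡.sym (ℤₚ.neg-distribʳ-* (+ m) (+ suc n))) ⟩
    fromℤ (ℤ.- (+ m ℤ.* + suc n))       ≈⟨ fromℤ-neg (+ m ℤ.* + suc n) ⟩
    - fromℤ (+ m ℤ.* + suc n)           ≈⟨ -‿cong (fromℤ-pos* m (+ suc n)) ⟩
    - (fromℕ m * fromℕ (suc n))         ≈⟨ -‿distribʳ-* _ _ ⟩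
    fromℕ m * - fromℕ (suc n)           ∎

  fromℤ-* : ∀ i j → fromℤ (i ℤ.* j) ≈ fromℤ i * fromℤ j
  fromℤ-* (+ m)    j = fromℤ-pos* m j
  fromℤ-* -[1+ m ] j = begin
    fromℤ (-[1+ m ] ℤ.* j)              ≡⟨ ≡.cong fromℤ (≡.sym (ℤₚ.neg-distribˡ-* (+ suc m) j)) ⟩
    fromℤ (ℤ.- (+ suc m ℤ.* j))         ≈⟨ fromℤ-neg (+ suc m ℤ.* j) ⟩
    - fromℤ (+ suc m ℤ.* j)             ≈⟨ -‿cong (fromℤ-pos* (suc m) j) ⟩
    - (fromℕ (suc m) * fromℤ j)         ≈⟨ -‿distribˡ-* _ _ ⟩
    - fromℕ (suc m) * fromℤ j           ∎

  fromℤ-morphism : ℤ.+-*-rawRing -Raw-AlmostCommutative⟶ fromCommutativeRing R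
  fromℤ-morphism = record
    { ⟦_⟧    = fromℤ
    ; +-homo = fromℤ-+
    ; *-homo = fromℤ-*
    ; -‿homo = fromℤ-neg
    ; 0-homo = refl
    ; 1-homo = refl
    }

  -- Distinct integers may have equal images, as in characteristic 3 or 4, so the test only ever
  -- confirms equality. Facts such as 3 = 0 enter the calculations as hypotheses.
  fromℤ≟ : ∀ i j → Maybe (fromℤ i ≈ fromℤ j)
  fromℤ≟ i j with i ℤ.≟ j
  ... | yes i≡j = just (reflexive (≡.cong fromℤ i≡j))
  ... | no _    = nothing

  open RingSolver ℤ.+-*-rawRing (fromCommutativeRing R) fromℤ-morphism fromℤ≟ public
    using (solve; con; _:=_; _:+_; _:*_; _:-_; :-_; _:^_)

-- Theta functions of a nilpotent argument

module FiniteProducts {c ℓ} (R : CommutativeRing c ℓ) where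
  open CommutativeRing R
  open IntegerCoefficients R
  open Exponentiation semiring using (_^_; ^-homo-*; ^-congˡ)
  open CommutativeExponentiation commutativeSemiring using (^-distrib-*)
  open SetoidReasoning setoid

  ∑ : ℕ → (ℕ → Carrier) → Carrier
  ∑ zero    f = 0#
  ∑ (suc n) f = ∑ n f + f n

  ∏ : ℕ → (ℕ → Carrier) → Carrier
  ∏ zero    f = 1#
  ∏ (suc n) f = ∏ n f * f n

  ∑-cong : ∀ n {f g} → (∀ k → f k ≈ g k) → ∑ n f ≈ ∑ n g
  ∑-cong zero    f≈g = refl
  ∑-cong (suc n) f≈g = +-cong (∑-cong n f≈g) (f≈g n)

  ∑-+ : ∀ n {f g} → ∑ n (λ k → f k + g k) ≈ ∑ n f + ∑ n g
  ∑-+ zero = sym (+-identityˡ 0#)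
  ∑-+ (suc n) {f} {g} = trans (+-congʳ (∑-+ n))
    (solve 4 (λ F G a b → F :+ G :+ (a :+ b) := F :+ a :+ (G :+ b)) refl (∑ n f) (∑ n g) (f n) (g n))

  ∑-*ˡ : ∀ n {f} a → ∑ n (λ k → a * f k) ≈ a * ∑ n f
  ∑-*ˡ zero    a = sym (zeroʳ a)
  ∑-*ˡ (suc n) a = trans (+-congʳ (∑-*ˡ n a)) (sym (distribˡ a _ _))

  ∑-head : ∀ n f → ∑ (suc n) f ≈ f 0 + ∑ n (f ∘ suc)
  ∑-head zero    f = +-comm _ _
  ∑-head (suc n) f = trans (+-congʳ (∑-head n f)) (+-assoc _ _ _)

  ∑-zero : ∀ n {f} → (∀ k → f k ≈ 0#) → ∑ n f ≈ 0#
  ∑-zero zero    f≈0 = refl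
  ∑-zero (suc n) f≈0 = trans (+-cong (∑-zero n f≈0) (f≈0 n)) (+-identityˡ 0#)

  ∑-even-odd : ∀ n f → ∑ (n ℕ.+ n) f ≈ ∑ n (λ k → f (k ℕ.+ k)) + ∑ n (λ k → f (suc (k ℕ.+ k)))
  ∑-even-odd zero    f = sym (+-identityˡ 0#)
  ∑-even-odd (suc n) f = begin
    ∑ (n ℕ.+ suc n) f + f (n ℕ.+ suc n)           ≡⟨ ≡.cong (λ k → ∑ k f + f k) (ℕₚ.+-suc n n) ⟩
    ∑ (n ℕ.+ n) f + f (n ℕ.+ n) + f (suc (n ℕ.+ n)) ≈⟨ +-congʳ (+-congʳ (∑-even-odd n f)) ⟩
    E + O + f (n ℕ.+ n) + f (suc (n ℕ.+ n))
      ≈⟨ solve 4 (λ E O a b → E :+ O :+ a :+ b := E :+ a :+ (O :+ b)) refl E O _ _ ⟩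
    E + f (n ℕ.+ n) + (O + f (suc (n ℕ.+ n)))     ∎
    where
    E = ∑ n (λ k → f (k ℕ.+ k))
    O = ∑ n (λ k → f (suc (k ℕ.+ k)))

  ∏-cong : ∀ n {f g} → (∀ k → f k ≈ g k) → ∏ n f ≈ ∏ n g
  ∏-cong zero    f≈g = refl
  ∏-cong (suc n) f≈g = *-cong (∏-cong n f≈g) (f≈g n)

  ∏-* : ∀ n {f g} → ∏ n (λ k → f k * g k) ≈ ∏ n f * ∏ n g
  ∏-* zero = sym (*-identityˡ 1#)
  ∏-* (suc n) {f} {g} = trans (*-congʳ (∏-* n))
    (solve 4 (λ F G a b → F :* G :* (a :* b) := F :* a :* (G :* b)) refl (∏ n f) (∏ n g) (f n) (g n))

  ∏-head : ∀ n f → ∏ (suc n) f ≈ f 0 * ∏ n (f ∘ suc)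
  ∏-head zero    f = *-comm _ _
  ∏-head (suc n) f = trans (*-congʳ (∏-head n f)) (*-assoc _ _ _)

  poch : ℕ → Carrier → Carrier → Carrier
  poch n z y = ∏ n (λ j → 1# + z * y ^ j)

  poch-cong : ∀ n {z z′ y y′} → z ≈ z′ → y ≈ y′ → poch n z y ≈ poch n z′ y′
  poch-cong n z≈ y≈ = ∏-cong n (λ j → +-congˡ (*-cong z≈ (^-congˡ j y≈)))

  poch-neg : ∀ n z y → poch n z y * poch n (- z) y ≈ poch n (- (z * z)) (y * y)
  poch-neg n z y = trans (sym (∏-* n)) (∏-cong n λ j → begin
    (1# + z * y ^ j) * (1# + - z * y ^ j)
      ≈⟨ solve 2 (λ z t → (con (+ 1) :+ z :* t) :* (con (+ 1) :+ :- z :* t) := con (+ 1) :+ :- (z :* z) :* (t :* t)) refl z (y ^ j) ⟩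
    1# + - (z * z) * (y ^ j * y ^ j)  ≈⟨ +-congˡ (*-congˡ (^-distrib-* y y j)) ⟨
    1# + - (z * z) * (y * y) ^ j      ∎)

  poch-split : ∀ n z y → poch n z (y * y) * poch n (z * y) (y * y) ≈ poch (n ℕ.+ n) z y
  poch-split zero    z y = *-identityˡ 1#
  poch-split (suc n) z y = begin
    U * (1# + z * t) * (V * (1# + z * y * t))
      ≈⟨ solve 4 (λ U V a b → U :* a :* (V :* b) := U :* V :* a :* b) refl U V (1# + z * t) (1# + z * y * t) ⟩
    U * V * (1# + z * t) * (1# + z * y * t)
      ≈⟨ *-cong (*-cong (poch-split n z y) (+-congˡ (*-congˡ t≈)))
                (+-congˡ (trans (*-assoc _ _ _) (*-congˡ (*-congˡ t≈)))) ⟩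
    poch (suc (suc (n ℕ.+ n))) z y    ≡⟨ ≡.cong (λ k → poch (suc k) z y) (≡.sym (ℕₚ.+-suc n n)) ⟩
    poch (suc n ℕ.+ suc n) z y        ∎
    where
    U = poch n z (y * y)
    V = poch n (z * y) (y * y)
    t = (y * y) ^ n
    t≈ : t ≈ y ^ (n ℕ.+ n)
    t≈ = trans (^-distrib-* y y n) (sym (^-homo-* y n n))

  module Nilpotent (N : ℕ) where

    Nil : Carrier → Set ℓ
    Nil x = x ^ N ≈ 0#

    ^-vanish : ∀ {x k} → Nil x → N ℕ.≤ k → x ^ k ≈ 0#
    ^-vanish {x} nil N≤k with ℕₚ.m≤n⇒∃[o]m+o≡n N≤k
    ... | o , ≡.refl = trans (^-homo-* x N o) (trans (*-congʳ nil) (zeroˡ _))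

    Nil-* : ∀ x {y} → Nil y → Nil (x * y)
    Nil-* x {y} nil = trans (^-distrib-* x y N) (trans (*-congˡ nil) (zeroʳ _))

    Nil-^ : ∀ {x} → Nil x → ∀ k → Nil (x ^ suc k)
    Nil-^ {x} nil k = trans (^-distrib-* x (x ^ k) N) (trans (*-congʳ nil) (zeroˡ _))

    Nil-neg : ∀ {x} → Nil x → Nil (- x)
    Nil-neg {x} nil = trans (^-congˡ N (sym (-1*x≈-x x))) (Nil-* (- 1#) nil)
      where open RingProperties ring using (-1*x≈-x)

    poch-stable : ∀ z {y} → Nil y → ∀ d → poch (d ℕ.+ N) z y ≈ poch N z y
    poch-stable z nil zero    = refl
    poch-stable z {y} nil (suc d) = begin
      poch (d ℕ.+ N) z y * (1# + z * y ^ (d ℕ.+ N))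
        ≈⟨ *-cong (poch-stable z nil d) (+-congˡ (*-congˡ (^-vanish nil (ℕₚ.m≤n+m N d)))) ⟩
      poch N z y * (1# + z * 0#)
        ≈⟨ solve 2 (λ P z → P :* (con (+ 1) :+ z :* con (+ 0)) := P) refl (poch N z y) z ⟩
      poch N z y  ∎

    poch-stable-≤ : ∀ z {y n} → Nil y → N ℕ.≤ n → poch n z y ≈ poch N z y
    poch-stable-≤ z {y} {n} nil N≤n = trans
      (reflexive (≡.cong (λ k → poch k z y) (≡.sym (ℕₚ.m∸n+n≡m N≤n)))) (poch-stable z nil (n ℕ.∸ N))

    -- Since y^j vanishes for j ≥ N, poch N z y is the infinite product (-z; y)_∞.
    A B C D Φ Ψ : Carrier → Carrier
    A x = poch N x (x * x)
    B x = poch N (- x) (x * x)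
    C x = poch N (x * x) (x * x)
    D x = poch N (- (x * x)) (x * x)
    -- The product sides of Gauss's formulas: `Φ x` for Σ x^(k²) over all integers k, `Ψ x` for Σ
    -- x^(k(k+1)) over k ≥ 0.
    Φ x = D x * (A x * A x)
    Ψ x = D x * (C x * C x)

    geometric : Carrier → Carrier
    geometric t = ∑ N (t ^_)

    geometric-sum : ∀ n t → (1# - t) * ∑ n (t ^_) ≈ 1# - t ^ n
    geometric-sum zero    t = trans (zeroʳ _) (sym (-‿inverseʳ 1#))
    geometric-sum (suc n) t = begin
      (1# - t) * (∑ n (t ^_) + t ^ n)            ≈⟨ distribˡ _ _ _ ⟩
      (1# - t) * ∑ n (t ^_) + (1# - t) * t ^ n   ≈⟨ +-congʳ (geometric-sum n t) ⟩
      (1# - t ^ n) + (1# - t) * t ^ n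
        ≈⟨ solve 2 (λ t u → (con (+ 1) :- u) :+ (con (+ 1) :- t) :* u := con (+ 1) :- t :* u) refl t (t ^ n) ⟩
      1# - t * t ^ n                              ∎

    geometric-inverse : ∀ {t} → Nil t → (1# - t) * geometric t ≈ 1#
    geometric-inverse {t} nil = begin
      (1# - t) * geometric t  ≈⟨ geometric-sum N t ⟩
      1# - t ^ N              ≈⟨ +-congˡ (-‿cong nil) ⟩
      1# - 0#                 ≈⟨ solve 0 (con (+ 1) :- con (+ 0) := con (+ 1)) refl ⟩
      1#                      ∎

    module _ {x : Carrier} (nil : Nil x) where

      private
        y = x * x

        nil-y : Nil y
        nil-y = Nil-* x nil

      -- 1 / ((1 - y) ... (1 - y^k))
      e : ℕ → Carrier
      e zero    = 1#
      e (suc k) = e k * geometric (y ^ suc k)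

      e-step : ∀ k → (1# - y ^ suc k) * e (suc k) ≈ e k
      e-step k = begin
        (1# - y ^ suc k) * (e k * geometric (y ^ suc k))
          ≈⟨ solve 3 (λ a b c → a :* (b :* c) := b :* (a :* c)) refl (1# - y ^ suc k) (e k) (geometric (y ^ suc k)) ⟩
        e k * ((1# - y ^ suc k) * geometric (y ^ suc k))  ≈⟨ *-congˡ (geometric-inverse (Nil-^ nil-y k)) ⟩
        e k * 1#                                           ≈⟨ *-identityʳ _ ⟩
        e k                                                ∎

      poch-e : ∀ k → poch k (- y) y * e k ≈ 1#
      poch-e zero    = *-identityˡ 1#
      poch-e (suc k) = begin
        poch k (- y) y * (1# + - y * y ^ k) * e (suc k)
          ≈⟨ solve 4 (λ P y t E → P :* (con (+ 1) :+ :- y :* t) :* E := P :* ((con (+ 1) :- y :* t) :* E)) refl (poch k (- y) y) y (y ^ k) (e (suc k)) ⟩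
        poch k (- y) y * ((1# - y * y ^ k) * e (suc k))  ≈⟨ *-congˡ (e-step k) ⟩
        poch k (- y) y * e k                               ≈⟨ poch-e k ⟩
        1#                                                 ∎

      -- From index `N` on the partial products no longer change, so `e k` has become the reciprocal
      -- of the whole of `D x`.
      D-e : ∀ {k} → N ℕ.≤ k → D x * e k ≈ 1#
      D-e {k} N≤k = trans (*-congʳ (sym (poch-stable-≤ (- y) nil-y N≤k))) (poch-e k)

      CD≈D[x²] : C x * D x ≈ D y
      CD≈D[x²] = poch-neg N y y

      AB≈B[x²] : A x * B x ≈ B y
      AB≈B[x²] = poch-neg N x y

      -- Euler's identity behind partitions into distinct parts and into odd parts. Multiplied by
      -- `D x`, the left side becomes `B y * D y`; these are the odd and even powers in the product
      -- of all 1 - y^k, which is `D x` again, and `D x` is invertible by `D-e`.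
      ABC≈1 : A x * B x * C x ≈ 1#
      ABC≈1 = begin
        A x * B x * C x
          ≈⟨ solve 2 (λ P d → P := P :* con (+ 1)) refl (A x * B x * C x) 1# ⟩
        A x * B x * C x * 1#                  ≈⟨ *-congˡ (D-e ℕₚ.≤-refl) ⟨
        A x * B x * C x * (D x * e N)
          ≈⟨ solve 4 (λ P C D E → P :* C :* (D :* E) := P :* (C :* D) :* E) refl (A x * B x) (C x) (D x) (e N) ⟩
        A x * B x * (C x * D x) * e N         ≈⟨ *-congʳ (*-cong AB≈B[x²] CD≈D[x²]) ⟩
        B y * D y * e N                       ≈⟨ *-congʳ (*-congˡ (poch-cong N (solve 1 (λ y → :- (y :* y) := :- y :* y) refl y) refl)) ⟩
        B y * poch N (- y * y) (y * y) * e N  ≈⟨ *-congʳ (poch-split N (- y) y) ⟩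
        poch (N ℕ.+ N) (- y) y * e N          ≈⟨ *-congʳ (poch-stable (- y) nil-y N) ⟩
        D x * e N                             ≈⟨ D-e ℕₚ.≤-refl ⟩
        1#                                    ∎

      Φ[-x] : Φ (- x) ≈ D x * (B x * B x)
      Φ[-x] = *-cong (poch-cong N (-‿cong x²) x²) (*-cong A[-x] A[-x])
        where
        x² : - x * - x ≈ x * x
        x² = solve 1 (λ x → :- x :* :- x := x :* x) refl x
        A[-x] : A (- x) ≈ B x
        A[-x] = poch-cong N refl x²

    -- Written in `A x`, `B x`, `C x`, `D x`, the two sides differ by the square of
    -- `A x * B x * C x`, which is 1.
    Φ[x]Φ[-x] : ∀ {x} → Nil x → Φ x * Φ (- x) ≈ Φ (- (x * x)) * Φ (- (x * x))
    Φ[x]Φ[-x] {x} nil = begin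
      Φ x * Φ (- x)                               ≈⟨ *-congˡ (Φ[-x] nil) ⟩
      D x * (A x * A x) * (D x * (B x * B x))
        ≈⟨ solve 4 (λ A B C D → D :* (A :* A) :* (D :* (B :* B)) := con (+ 1) :* con (+ 1) :* ((A :* B) :* (A :* B) :* (D :* D)))
             refl (A x) (B x) (C x) (D x) ⟩
      1# * 1# * (A x * B x * (A x * B x) * (D x * D x))
        ≈⟨ *-congʳ (*-cong (ABC≈1 nil) (ABC≈1 nil)) ⟨
      A x * B x * C x * (A x * B x * C x) * (A x * B x * (A x * B x) * (D x * D x))
        ≈⟨ solve 3 (λ AB C D → AB :* C :* (AB :* C) :* (AB :* AB :* (D :* D)) := C :* D :* (AB :* AB) :* (C :* D :* (AB :* AB)))
             refl (A x * B x) (C x) (D x) ⟩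
      C x * D x * (A x * B x * (A x * B x)) * (C x * D x * (A x * B x * (A x * B x)))
        ≈⟨ *-cong same same ⟩
      Φ (- (x * x)) * Φ (- (x * x))               ∎
      where
      same : C x * D x * (A x * B x * (A x * B x)) ≈ Φ (- (x * x))
      same = trans (*-cong (CD≈D[x²] nil) (*-cong (AB≈B[x²] nil) (AB≈B[x²] nil))) (sym (Φ[-x] (Nil-* x nil)))

-- Gauss's product formulas

module Exponents (c d : ℕ) where
  open +-*-Solver

  -- For c + d = 1, ε k n = (k - n)² + c (k - n), where k - n may be negative.
  ε : ℕ → ℕ → ℕ
  ε k       zero    = k ℕ.* k ℕ.+ c ℕ.* k
  ε zero    (suc n) = ε zero n ℕ.+ (n ℕ.+ n ℕ.+ d)
  ε (suc k) (suc n) = ε k n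

  -- Replacing j = k - n by j - 1 changes j² + c j by 1 - c - 2 j; the equation states this without
  -- subtraction.
  ε-step : c ℕ.+ d ≡ 1 → ∀ k n → ε k (suc n) ℕ.+ (k ℕ.+ k) ≡ ε k n ℕ.+ (n ℕ.+ n ℕ.+ d)
  ε-step c+d≡1 zero    n       = ℕₚ.+-identityʳ _
  ε-step c+d≡1 (suc k) zero    = ≡.trans
    (solve 2 (λ k c → k :* k :+ c :* k :+ (con 1 :+ k :+ (con 1 :+ k))
                   := k :* k :+ c :* k :+ k :+ k :+ con 1 :+ con 1) ≡.refl k c)
    (≡.trans (≡.cong (λ s → k ℕ.* k ℕ.+ c ℕ.* k ℕ.+ k ℕ.+ k ℕ.+ 1 ℕ.+ s) (≡.sym c+d≡1))
    (solve 3 (λ k c d → k :* k :+ c :* k :+ k :+ k :+ con 1 :+ (c :+ d)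
                   := (con 1 :+ k) :* (con 1 :+ k) :+ c :* (con 1 :+ k) :+ d) ≡.refl k c d))
  ε-step c+d≡1 (suc k) (suc n) = ≡.trans
    (solve 2 (λ E k → E :+ (con 1 :+ k :+ (con 1 :+ k)) := con 2 :+ (E :+ (k :+ k))) ≡.refl (ε k (suc n)) k)
    (≡.trans (≡.cong (2 ℕ.+_) (ε-step c+d≡1 k n))
    (solve 3 (λ E n d → con 2 :+ (E :+ (n :+ n :+ d)) := E :+ (con 1 :+ n :+ (con 1 :+ n) :+ d)) ≡.refl (ε k n) n d))

  ε-right : ∀ n m → m ℕ.≤ ε (n ℕ.+ m) n
  ε-right zero    zero      = ℕ.z≤n
  ε-right zero    m@(suc _) = ℕₚ.≤-trans (ℕₚ.m≤m*n m m) (ℕₚ.m≤m+n _ _)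
  ε-right (suc n) m         = ε-right n m

  ε-left : ∀ k m → m ℕ.≤ ε k (suc k ℕ.+ m)
  ε-left zero    m = ℕₚ.≤-trans (ℕₚ.m≤m+n m m) (ℕₚ.≤-trans (ℕₚ.m≤m+n _ d) (ℕₚ.m≤n+m _ (ε zero m)))
  ε-left (suc k) m = ε-left k m

  -- With `ε-large-left` this confines the nonzero powers of a nilpotent element to a window around
  -- k = n, so that a bilateral series becomes a finite sum over natural k.
  ε-large-right : ∀ {N k n} → n ℕ.+ N ℕ.≤ k → N ℕ.≤ ε k n
  ε-large-right {N} {k} {n} n+N≤k with ℕₚ.m≤n⇒∃[o]m+o≡n n+N≤k
  ... | o , ≡.refl = ℕₚ.≤-trans (ℕₚ.m≤m+n N o)
    (≡.subst (λ t → N ℕ.+ o ℕ.≤ ε t n) (≡.sym (ℕₚ.+-assoc n N o)) (ε-right n (N ℕ.+ o)))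

  ε-large-left : ∀ {N k n} → suc k ℕ.+ N ℕ.≤ n → N ℕ.≤ ε k n
  ε-large-left {N} {k} {n} k+N<n with ℕₚ.m≤n⇒∃[o]m+o≡n k+N<n
  ... | o , ≡.refl = ℕₚ.≤-trans (ℕₚ.m≤m+n N o)
    (≡.subst (λ t → N ℕ.+ o ℕ.≤ ε k (suc t)) (≡.sym (ℕₚ.+-assoc k N o)) (ε-left k (N ℕ.+ o)))

  -- The exponent of x in y^(k(k-1)/2) w^k for y = x² and w = x^(c+1) y^m, the numerator of a term
  -- in Euler's expansion of (-w; y)_∞.
  ρ : ℕ → ℕ → ℕ
  ρ m k = k ℕ.* k ℕ.+ c ℕ.* k ℕ.+ (m ℕ.+ m) ℕ.* k

  ρ-suc : ∀ m k → ρ m (suc k) ℕ.+ (suc k ℕ.+ suc k) ≡ ρ (suc m) (suc k)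
  ρ-suc m k = solve 3 (λ m k c → let k⁺ = con 1 :+ k ; m⁺ = con 1 :+ m in
    k⁺ :* k⁺ :+ c :* k⁺ :+ (m :+ m) :* k⁺ :+ (k⁺ :+ k⁺) := k⁺ :* k⁺ :+ c :* k⁺ :+ (m⁺ :+ m⁺) :* k⁺) ≡.refl m k c

  ρ-shift : ∀ m k → ρ m (suc k) ≡ m ℕ.+ m ℕ.+ suc c ℕ.+ ρ (suc m) k
  ρ-shift m k = solve 3 (λ m k c → let k⁺ = con 1 :+ k ; m⁺ = con 1 :+ m in
    k⁺ :* k⁺ :+ c :* k⁺ :+ (m :+ m) :* k⁺
      := m :+ m :+ (con 1 :+ c) :+ (k :* k :+ c :* k :+ (m⁺ :+ m⁺) :* k)) ≡.refl m k c

open Exponents 0 1 using () renaming (ε to square; ε-step to square-step)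
open Exponents 1 0 using () renaming (ε to pronic)

square-even : ∀ k n → square (k ℕ.+ k) (n ℕ.+ n) ≡ 4 ℕ.* square k n
square-even k       zero    = solve 1 (λ k → (k :+ k) :* (k :+ k) :+ con 0 := con 4 :* (k :* k :+ con 0)) ≡.refl k
  where open +-*-Solver
square-even zero    (suc n) = ≡.trans (≡.cong (square 0 ∘ suc) (ℕₚ.+-suc n n))
  (≡.trans (≡.cong (λ s → s ℕ.+ (n ℕ.+ n ℕ.+ (n ℕ.+ n) ℕ.+ 1) ℕ.+ (suc (n ℕ.+ n) ℕ.+ suc (n ℕ.+ n) ℕ.+ 1)) (square-even 0 n))
  (solve 2 (λ S n → con 4 :* S :+ (n :+ n :+ (n :+ n) :+ con 1) :+ (con 1 :+ (n :+ n) :+ (con 1 :+ (n :+ n)) :+ con 1)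
                 := con 4 :* (S :+ (n :+ n :+ con 1))) ≡.refl (square 0 n) n))
  where open +-*-Solver
square-even (suc k) (suc n) = ≡.trans (≡.cong₂ square (ℕₚ.+-suc k k) (ℕₚ.+-suc n n)) (square-even k n)

-- This is (2 j + 1)² = 4 j (j + 1) + 1 for j = k - n; the induction is there because j may be
-- negative.
square-odd : ∀ k n → square (suc (k ℕ.+ k)) (n ℕ.+ n) ≡ suc (4 ℕ.* pronic k n)
square-odd k       zero    = solve 1 (λ k → (con 1 :+ (k :+ k)) :* (con 1 :+ (k :+ k)) :+ con 0
                                         := con 1 :+ con 4 :* (k :* k :+ (k :+ con 0))) ≡.refl k
  where open +-*-Solver
square-odd zero    (suc n) = ≡.trans (≡.cong (square 0) (ℕₚ.+-suc n n)) (≡.trans (square-step-1 (n ℕ.+ n))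
  (≡.trans (≡.cong (ℕ._+ (n ℕ.+ n ℕ.+ (n ℕ.+ n) ℕ.+ (n ℕ.+ n ℕ.+ (n ℕ.+ n)))) (square-odd 0 n))
  (solve 2 (λ S n → con 1 :+ con 4 :* S :+ (n :+ n :+ (n :+ n) :+ (n :+ n :+ (n :+ n)))
                 := con 1 :+ con 4 :* (S :+ (n :+ n :+ con 0))) ≡.refl (pronic 0 n) n)))
  where
  open +-*-Solver
  -- (m + 1)² = (m - 1)² + 4 m, where `square 1 m` stands for (1 - m)².
  square-step-1 : ∀ m → square 0 (suc m) ≡ square 1 m ℕ.+ (m ℕ.+ m ℕ.+ (m ℕ.+ m))
  square-step-1 zero    = ≡.refl
  square-step-1 (suc m) = solve 2 (λ S m → S :+ (m :+ m :+ con 1) :+ (con 1 :+ m :+ (con 1 :+ m) :+ con 1)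
                                        := S :+ (con 1 :+ m :+ (con 1 :+ m) :+ (con 1 :+ m :+ (con 1 :+ m)))) ≡.refl (square 0 m) m
square-odd (suc k) (suc n) = ≡.trans (≡.cong₂ (square ∘ suc) (ℕₚ.+-suc k k) (ℕₚ.+-suc n n)) (square-odd k n)

module GaussIdentities {c ℓ} (R : CommutativeRing c ℓ) (N : ℕ) where
  open CommutativeRing R
  open IntegerCoefficients R
  open Exponentiation semiring using (_^_; ^-homo-*; ^-assocʳ; ^-congʳ)
  open CommutativeExponentiation commutativeSemiring using (^-distrib-*)
  open SetoidReasoning setoid
  open FiniteProducts R
  open Nilpotent N

  module _ {x : Carrier} (nil : Nil x) where

    private
      y = x * x

      nil-y : Nil y
      nil-y = Nil-* x nil

      y^ : ∀ k → y ^ k ≈ x ^ (k ℕ.+ k)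
      y^ k = trans (^-distrib-* x x k) (sym (^-homo-* x k k))

      x^+y^ : ∀ a k → x ^ (k ℕ.+ k ℕ.+ a) ≈ x ^ a * y ^ k
      x^+y^ a k = trans (^-homo-* x (k ℕ.+ k) a) (trans (*-comm _ _) (*-congˡ (sym (y^ k))))

      e-expand : ∀ m k → x ^ m * e nil k ≈ x ^ m * e nil (suc k) - x ^ (m ℕ.+ (suc k ℕ.+ suc k)) * e nil (suc k)
      e-expand m k = begin
        x ^ m * e nil k                               ≈⟨ *-congˡ (e-step nil k) ⟨
        x ^ m * ((1# - y ^ suc k) * e nil (suc k))
          ≈⟨ solve 3 (λ X Y E → X :* ((con (+ 1) :- Y) :* E) := X :* E :- X :* Y :* E) refl (x ^ m) (y ^ suc k) (e nil (suc k)) ⟩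
        x ^ m * e nil (suc k) - x ^ m * y ^ suc k * e nil (suc k)
          ≈⟨ +-congˡ (-‿cong (*-congʳ (trans (*-congˡ (y^ (suc k))) (sym (^-homo-* x m _))))) ⟩
        x ^ m * e nil (suc k) - x ^ (m ℕ.+ (suc k ℕ.+ suc k)) * e nil (suc k) ∎

      move : ∀ {a b c} → a ≈ b - c → b ≈ c + a
      move {a} {b} {c} a≈b-c = trans (solve 2 (λ b c → b := c :+ (b :- c)) refl b c) (+-congˡ (sym a≈b-c))

    module _ (c d : ℕ) (c+d≡1 : c ℕ.+ d ≡ 1) where
      open Exponents c d

      term : ℕ → ℕ → Carrier
      term n k = x ^ ε k n * e nil k

      -- `ε (suc k) (suc n)` is `ε k n` by definition, so `term (suc n) (suc k)` and `term n k`
      -- differ only in the index of `e`. The relation `e-step` supplies the difference, and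
      -- `ε-step` rewrites its exponent in terms of `ε (suc k) n`.
      term-step : ∀ n k → term (suc n) (suc k) ≈ x ^ (n ℕ.+ n ℕ.+ d) * term n (suc k) + term n k
      term-step n k = trans (move (e-expand (ε k n) k)) (+-congʳ (begin
        x ^ (ε k n ℕ.+ (suc k ℕ.+ suc k)) * e nil (suc k)
          ≈⟨ *-congʳ (^-congʳ x (≡.trans (ε-step c+d≡1 (suc k) n) (ℕₚ.+-comm (ε (suc k) n) _))) ⟩
        x ^ (n ℕ.+ n ℕ.+ d ℕ.+ ε (suc k) n) * e nil (suc k)  ≈⟨ *-congʳ (^-homo-* x (n ℕ.+ n ℕ.+ d) _) ⟩
        x ^ (n ℕ.+ n ℕ.+ d) * x ^ ε (suc k) n * e nil (suc k) ≈⟨ *-assoc _ _ _ ⟩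
        x ^ (n ℕ.+ n ℕ.+ d) * term n (suc k) ∎))

      -- S multiplied by (y; y)_∞ tends to the theta series Σ x^(j² + c j) over j ≥ -n; shifting n
      -- contributes one factor 1 + x^(2n + d).
      S : ℕ → ℕ → Carrier
      S L n = ∑ L (term n)

      S-shift : ∀ L n → S (suc L) (suc n) ≈ x ^ (n ℕ.+ n ℕ.+ d) * S (suc L) n + S L n
      S-shift L n = begin
        S (suc L) (suc n)                                     ≈⟨ ∑-head L (term (suc n)) ⟩
        term (suc n) 0 + ∑ L (term (suc n) ∘ suc)             ≈⟨ +-cong zeroth (∑-cong L (term-step n)) ⟩
        X * term n 0 + ∑ L (λ k → X * term n (suc k) + term n k) ≈⟨ +-congˡ (trans (∑-+ L) (+-congʳ (∑-*ˡ L X))) ⟩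
        X * term n 0 + (X * ∑ L (term n ∘ suc) + S L n)
          ≈⟨ solve 4 (λ X a b c → X :* a :+ (X :* b :+ c) := X :* (a :+ b) :+ c) refl X (term n 0) (∑ L (term n ∘ suc)) (S L n) ⟩
        X * (term n 0 + ∑ L (term n ∘ suc)) + S L n           ≈⟨ +-congʳ (*-congˡ (∑-head L (term n))) ⟨
        X * S (suc L) n + S L n                               ∎
        where
        X = x ^ (n ℕ.+ n ℕ.+ d)
        zeroth : term (suc n) 0 ≈ X * term n 0
        zeroth = trans (*-congʳ (trans (^-homo-* x (ε 0 n) _) (*-comm _ _))) (*-assoc _ _ _)

      -- Identifies the two lengths that occur in `S-shift`; the recursion then becomes
      -- multiplication by 1 + x^(2n+d).
      S-drop : ∀ {L n} → n ℕ.+ N ℕ.≤ L → S (suc L) n ≈ S L n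
      S-drop {L} {n} n+N≤L = trans
        (+-congˡ (trans (*-congʳ (^-vanish nil (ε-large-right n+N≤L))) (zeroˡ _))) (+-identityʳ _)

      S-product : ∀ {L} n → n ℕ.+ N ℕ.≤ L → S (suc L) n ≈ poch n (x ^ d) y * S (suc L) 0
      S-product zero    n+N≤L = sym (*-identityˡ _)
      S-product {L} (suc n) 1+n+N≤L = begin
        S (suc L) (suc n)                             ≈⟨ S-shift L n ⟩
        x ^ (n ℕ.+ n ℕ.+ d) * S (suc L) n + S L n     ≈⟨ +-congˡ (S-drop n+N≤L) ⟨
        x ^ (n ℕ.+ n ℕ.+ d) * S (suc L) n + S (suc L) n
          ≈⟨ solve 2 (λ X S → X :* S :+ S := S :* (con (+ 1) :+ X)) refl (x ^ (n ℕ.+ n ℕ.+ d)) (S (suc L) n) ⟩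
        S (suc L) n * (1# + x ^ (n ℕ.+ n ℕ.+ d))      ≈⟨ *-cong (S-product n n+N≤L) (+-congˡ (x^+y^ d n)) ⟩
        poch n (x ^ d) y * S (suc L) 0 * (1# + x ^ d * y ^ n)
          ≈⟨ solve 3 (λ P S a → P :* S :* a := P :* a :* S) refl (poch n (x ^ d) y) (S (suc L) 0) (1# + x ^ d * y ^ n) ⟩
        poch (suc n) (x ^ d) y * S (suc L) 0          ∎
        where
        n+N≤L = ℕₚ.≤-trans (ℕₚ.n≤1+n _) 1+n+N≤L

      tail : ℕ → ℕ → Carrier
      tail m k = x ^ ρ m k * e nil k

      tail-step : ∀ m k → tail m (suc k) ≈ tail (suc m) (suc k) + x ^ (m ℕ.+ m ℕ.+ suc c) * tail (suc m) k
      tail-step m k = begin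
        tail m (suc k)
          ≈⟨ move (e-expand (ρ m (suc k)) k) ⟩
        x ^ (ρ m (suc k) ℕ.+ (suc k ℕ.+ suc k)) * e nil (suc k) + x ^ ρ m (suc k) * e nil k
          ≈⟨ +-cong (*-congʳ (^-congʳ x (ρ-suc m k))) (*-congʳ (trans (^-congʳ x (ρ-shift m k)) (^-homo-* x (m ℕ.+ m ℕ.+ suc c) _))) ⟩
        tail (suc m) (suc k) + x ^ (m ℕ.+ m ℕ.+ suc c) * x ^ ρ (suc m) k * e nil k
          ≈⟨ +-congˡ (*-assoc _ _ _) ⟩
        tail (suc m) (suc k) + x ^ (m ℕ.+ m ℕ.+ suc c) * tail (suc m) k ∎

      tail-vanish : ∀ m k → N ℕ.≤ ρ m k → tail m k ≈ 0#
      tail-vanish m k N≤ρ = trans (*-congʳ (^-vanish nil N≤ρ)) (zeroˡ _)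

      -- Euler's series Σ y^(k(k-1)/2) w^k / ((1 - y) ... (1 - y^k)) for (-w; y)_∞, at w = x^(c+1)
      -- y^m. `T-shift` is its functional equation, which peels off the factor 1 + w; after `N`
      -- peelings w is zero and only the term k = 0 is left.
      T : ℕ → ℕ → Carrier
      T L m = ∑ L (tail m)

      T-shift : ∀ L m → T (suc L) m ≈ T (suc L) (suc m) + x ^ (m ℕ.+ m ℕ.+ suc c) * T L (suc m)
      T-shift L m = begin
        T (suc L) m                                     ≈⟨ ∑-head L (tail m) ⟩
        tail m 0 + ∑ L (tail m ∘ suc)                   ≈⟨ +-cong zeroth (∑-cong L (tail-step m)) ⟩
        tail (suc m) 0 + ∑ L (λ k → tail (suc m) (suc k) + X * tail (suc m) k) ≈⟨ +-congˡ (trans (∑-+ L) (+-congˡ (∑-*ˡ L X))) ⟩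
        tail (suc m) 0 + (∑ L (tail (suc m) ∘ suc) + X * T L (suc m))          ≈⟨ +-assoc _ _ _ ⟨
        tail (suc m) 0 + ∑ L (tail (suc m) ∘ suc) + X * T L (suc m)            ≈⟨ +-congʳ (∑-head L (tail (suc m))) ⟨
        T (suc L) (suc m) + X * T L (suc m)             ∎
        where
        X = x ^ (m ℕ.+ m ℕ.+ suc c)
        zeroth : tail m 0 ≈ tail (suc m) 0
        zeroth = *-congʳ (^-congʳ x (≡.cong (c ℕ.* 0 ℕ.+_) (≡.trans (ℕₚ.*-zeroʳ (m ℕ.+ m)) (≡.sym (ℕₚ.*-zeroʳ (suc m ℕ.+ suc m))))))

      T-product : ∀ {L} m → N ℕ.≤ L → T (suc L) 0 ≈ poch m (x ^ suc c) y * T (suc L) m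
      T-product zero    N≤L = sym (*-identityˡ _)
      T-product {L} (suc m) N≤L = begin
        T (suc L) 0                                     ≈⟨ T-product m N≤L ⟩
        P * T (suc L) m                                 ≈⟨ *-congˡ (T-shift L m) ⟩
        P * (T (suc L) (suc m) + x ^ (m ℕ.+ m ℕ.+ suc c) * T L (suc m))
          ≈⟨ *-congˡ (+-congˡ (*-cong (x^+y^ (suc c) m) (sym (trans (+-congˡ (tail-vanish (suc m) L large)) (+-identityʳ _))))) ⟩
        P * (T (suc L) (suc m) + x ^ suc c * y ^ m * T (suc L) (suc m))
          ≈⟨ solve 3 (λ P T a → P :* (T :+ a :* T) := P :* (con (+ 1) :+ a) :* T) refl P (T (suc L) (suc m)) (x ^ suc c * y ^ m) ⟩
        poch (suc m) (x ^ suc c) y * T (suc L) (suc m)  ∎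
        where
        P = poch m (x ^ suc c) y
        large : N ℕ.≤ ρ (suc m) L
        large = ℕₚ.≤-trans N≤L (ℕₚ.≤-trans (ℕₚ.m≤m+n L _) (ℕₚ.m≤n+m _ (L ℕ.* L ℕ.+ c ℕ.* L)))

      T-end : ∀ L → T (suc L) N ≈ 1#
      T-end L = begin
        T (suc L) N                     ≈⟨ ∑-head L (tail N) ⟩
        tail N 0 + ∑ L (tail N ∘ suc)   ≈⟨ +-cong (*-identityʳ _) (∑-zero L (λ k → tail-vanish N (suc k) (large k))) ⟩
        x ^ ρ N 0 + 0#                  ≈⟨ +-identityʳ _ ⟩
        x ^ ρ N 0                       ≡⟨ ≡.cong (x ^_) (≡.cong₂ ℕ._+_ (ℕₚ.*-zeroʳ c) (ℕₚ.*-zeroʳ (N ℕ.+ N))) ⟩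
        1#                              ∎
        where
        large : ∀ k → N ℕ.≤ ρ N (suc k)
        large k = ℕₚ.≤-trans (ℕₚ.m≤m+n N N) (ℕₚ.≤-trans (ℕₚ.m≤m*n (N ℕ.+ N) (suc k)) (ℕₚ.m≤n+m _ (suc k ℕ.* suc k ℕ.+ c ℕ.* suc k)))

      S-start : ∀ {L} → N ℕ.≤ L → S (suc L) 0 ≈ poch N (x ^ suc c) y
      S-start {L} N≤L = begin
        S (suc L) 0                               ≈⟨ ∑-cong (suc L) (λ k → *-congʳ (^-congʳ x (≡.sym (ℕₚ.+-identityʳ (k ℕ.* k ℕ.+ c ℕ.* k))))) ⟩
        T (suc L) 0                               ≈⟨ T-product N N≤L ⟩
        poch N (x ^ suc c) y * T (suc L) N        ≈⟨ *-congˡ (T-end L) ⟩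
        poch N (x ^ suc c) y * 1#                 ≈⟨ *-identityʳ _ ⟩
        poch N (x ^ suc c) y                      ∎

      -- Jacobi's triple product for the exponents j² + c j. The weight `e k` is absorbed by `D x`
      -- when k ≥ N; when k < N, the bound n ≥ 2 N places k so far left of the centre that the power
      -- of x is zero anyway.
      theta-product : ∀ {L n} → N ℕ.+ N ℕ.≤ n → n ℕ.+ N ℕ.≤ L →
        ∑ (suc L) (λ k → x ^ ε k n) ≈ D x * (poch n (x ^ d) y * poch N (x ^ suc c) y)
      theta-product {L} {n} 2N≤n n+N≤L = begin
        ∑ (suc L) (λ k → x ^ ε k n)         ≈⟨ ∑-cong (suc L) absorb ⟨
        ∑ (suc L) (λ k → D x * term n k)    ≈⟨ ∑-*ˡ (suc L) (D x) ⟩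
        D x * S (suc L) n                   ≈⟨ *-congˡ (S-product n n+N≤L) ⟩
        D x * (poch n (x ^ d) y * S (suc L) 0)
          ≈⟨ *-congˡ (*-congˡ (S-start (ℕₚ.≤-trans (ℕₚ.m≤n+m N n) n+N≤L))) ⟩
        D x * (poch n (x ^ d) y * poch N (x ^ suc c) y) ∎
        where
        absorb : ∀ k → D x * term n k ≈ x ^ ε k n
        absorb k with N ℕ.≤? k
        ... | yes N≤k = begin
          D x * (x ^ ε k n * e nil k)
            ≈⟨ solve 3 (λ D X E → D :* (X :* E) := X :* (D :* E)) refl (D x) (x ^ ε k n) (e nil k) ⟩
          x ^ ε k n * (D x * e nil k)   ≈⟨ *-congˡ (D-e nil N≤k) ⟩
          x ^ ε k n * 1#                ≈⟨ *-identityʳ _ ⟩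
          x ^ ε k n                     ∎
        ... | no N≰k = begin
          D x * (x ^ ε k n * e nil k)   ≈⟨ *-congˡ (*-congʳ vanish) ⟩
          D x * (0# * e nil k)          ≈⟨ trans (*-congˡ (zeroˡ _)) (zeroʳ _) ⟩
          0#                            ≈⟨ vanish ⟨
          x ^ ε k n                     ∎
          where
          vanish : x ^ ε k n ≈ 0#
          vanish = ^-vanish nil (ε-large-left (ℕₚ.≤-trans (ℕₚ.+-monoˡ-≤ N (ℕₚ.≰⇒> N≰k)) 2N≤n))

    square-sum : ∀ {L n} → N ℕ.+ N ℕ.≤ n → n ℕ.+ N ℕ.≤ L → ∑ (suc L) (λ k → x ^ square k n) ≈ Φ x
    square-sum {n = n} 2N≤n n+N≤L = trans (theta-product 0 1 ≡.refl 2N≤n n+N≤L)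
      (*-congˡ (*-cong (trans (poch-stable-≤ _ nil-y (ℕₚ.≤-trans (ℕₚ.m≤m+n N N) 2N≤n)) same) same))
      where
      same : poch N (x ^ 1) y ≈ A x
      same = poch-cong N (*-identityʳ x) refl

    -- The symmetry j ↦ -1 - j makes every value j (j + 1) occur twice. On the product side the
    -- doubling is the factor 1 + y^0.
    pronic-sum : ∀ {L n} → N ℕ.+ N ℕ.≤ n → n ℕ.+ N ℕ.≤ L → ∑ (suc L) (λ k → x ^ pronic k n) ≈ Ψ x + Ψ x
    pronic-sum {L} {n} 2N≤n n+N≤L = begin
      ∑ (suc L) (λ k → x ^ pronic k n)          ≈⟨ theta-product 1 0 ≡.refl 2N≤n n+N≤L ⟩
      D x * (poch n 1# y * poch N (x ^ 2) y)    ≈⟨ *-congˡ (*-cong first (poch-cong N (*-congˡ (*-identityʳ x)) refl)) ⟩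
      D x * ((C x + C x) * C x)
        ≈⟨ solve 2 (λ D C → D :* ((C :+ C) :* C) := D :* (C :* C) :+ D :* (C :* C)) refl (D x) (C x) ⟩
      Ψ x + Ψ x                                 ∎
      where
      first : poch n 1# y ≈ C x + C x
      first = begin
        poch n 1# y          ≈⟨ poch-stable-≤ 1# nil-y (ℕₚ.≤-trans (ℕₚ.m≤m+n N N) 2N≤n) ⟩
        -- One more factor changes nothing, and after the factor 1 + 1 is taken off exactly `N`
        -- factors remain, as `C x` requires.
        poch N 1# y          ≈⟨ poch-stable 1# nil-y 1 ⟨
        poch (suc N) 1# y    ≈⟨ ∏-head N (λ j → 1# + 1# * y ^ j) ⟩
        (1# + 1# * 1#) * ∏ N (λ j → 1# + 1# * y ^ suc j) ≈⟨ *-congˡ (∏-cong N (λ j → +-congˡ (*-identityˡ _))) ⟩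
        (1# + 1# * 1#) * C x ≈⟨ solve 1 (λ C → (con (+ 1) :+ con (+ 1) :* con (+ 1)) :* C := C :+ C) refl (C x) ⟩
        C x + C x            ∎

  Φ-split : ∀ {x} → Nil x → Φ x ≈ Φ (x ^ 4) + x * (Ψ (x ^ 4) + Ψ (x ^ 4))
  Φ-split {x} nil = begin
    Φ x                                                   ≈⟨ square-sum nil 2N≤n+n large ⟨
    ∑ (suc L ℕ.+ suc L) (λ k → x ^ square k (n ℕ.+ n))    ≈⟨ ∑-even-odd (suc L) (λ k → x ^ square k (n ℕ.+ n)) ⟩
    ∑ (suc L) (λ k → x ^ square (k ℕ.+ k) (n ℕ.+ n)) + ∑ (suc L) (λ k → x ^ square (suc (k ℕ.+ k)) (n ℕ.+ n))
      ≈⟨ +-cong (∑-cong (suc L) even) (trans (∑-cong (suc L) odd) (∑-*ˡ (suc L) x)) ⟩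
    ∑ (suc L) (λ k → (x ^ 4) ^ square k n) + x * ∑ (suc L) (λ k → (x ^ 4) ^ pronic k n)
      ≈⟨ +-cong (square-sum nil⁴ ℕₚ.≤-refl ℕₚ.≤-refl) (*-congˡ (pronic-sum nil⁴ ℕₚ.≤-refl ℕₚ.≤-refl)) ⟩
    Φ (x ^ 4) + x * (Ψ (x ^ 4) + Ψ (x ^ 4))               ∎
    where
    -- The full sum is centred at the even number `n + n`, so k and k - (n + n) have the same
    -- parity, and each half is again a sum centred at `n`. The values of `n` and `L` are the least
    -- that `square-sum` and `pronic-sum` accept for the halves.
    n = N ℕ.+ N
    L = n ℕ.+ N
    nil⁴ : Nil (x ^ 4)
    nil⁴ = Nil-^ nil 3
    2N≤n+n : N ℕ.+ N ℕ.≤ n ℕ.+ n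
    2N≤n+n = ℕₚ.m≤m+n n n
    large : n ℕ.+ n ℕ.+ N ℕ.≤ L ℕ.+ suc L
    large = ℕₚ.≤-trans (ℕₚ.≤-reflexive (ℕₚ.+-assoc n n N)) (ℕₚ.+-mono-≤ (ℕₚ.m≤m+n n N) (ℕₚ.n≤1+n L))
    even : ∀ k → x ^ square (k ℕ.+ k) (n ℕ.+ n) ≈ (x ^ 4) ^ square k n
    even k = trans (^-congʳ x (square-even k n)) (sym (^-assocʳ x 4 (square k n)))
    odd : ∀ k → x ^ square (suc (k ℕ.+ k)) (n ℕ.+ n) ≈ x * (x ^ 4) ^ pronic k n
    odd k = trans (^-congʳ x (square-odd k n)) (*-congˡ (sym (^-assocʳ x 4 (pronic k n))))

-- The quotient Φ(-x)/Φ(x) in characteristic three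

module CharacteristicThree {c ℓ} (R : CommutativeRing c ℓ) where
  open CommutativeRing R
  open IntegerCoefficients R
  open FiniteProducts R
  open Exponentiation semiring using (_^_; ^-assocʳ; ^-congʳ)
  open CommutativeExponentiation commutativeSemiring using (^-distrib-*)
  open SetoidReasoning setoid

  module _ (3≈0 : fromℕ 3 ≈ 0#) where

    cube-1+ : ∀ x → (1# + x) ^ 3 ≈ 1# + x ^ 3
    cube-1+ x = begin
      (1# + x) ^ 3
        ≈⟨ solve 1 (λ x → (con (+ 1) :+ x) :^ 3 := con (+ 1) :+ x :^ 3 :+ con (+ 3) :* (x :+ x :* x)) refl x ⟩
      1# + x ^ 3 + fromℕ 3 * (x + x * x)   ≈⟨ +-congˡ (trans (*-congʳ 3≈0) (zeroˡ _)) ⟩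
      1# + x ^ 3 + 0#                      ≈⟨ +-identityʳ _ ⟩
      1# + x ^ 3                           ∎

    cube-1- : ∀ x → (1# - x) ^ 3 ≈ 1# - x ^ 3
    cube-1- x = trans (cube-1+ (- x)) (+-congˡ (solve 1 (λ x → (:- x) :^ 3 := :- (x :^ 3)) refl x))

    poch-cube : ∀ n z y → poch n z y ^ 3 ≈ poch n (z ^ 3) (y ^ 3)
    poch-cube zero    z y = solve 0 (con (+ 1) :^ 3 := con (+ 1)) refl
    poch-cube (suc n) z y = begin
      (poch n z y * (1# + z * y ^ n)) ^ 3             ≈⟨ ^-distrib-* (poch n z y) _ 3 ⟩
      poch n z y ^ 3 * (1# + z * y ^ n) ^ 3           ≈⟨ *-cong (poch-cube n z y) (cube-1+ (z * y ^ n)) ⟩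
      poch n (z ^ 3) (y ^ 3) * (1# + (z * y ^ n) ^ 3) ≈⟨ *-congˡ (+-congˡ (trans (^-distrib-* z (y ^ n) 3) (*-congˡ swap))) ⟩
      poch (suc n) (z ^ 3) (y ^ 3)                    ∎
      where
      swap : (y ^ n) ^ 3 ≈ (y ^ 3) ^ n
      swap = trans (^-assocʳ y n 3) (trans (^-congʳ y (ℕₚ.*-comm n 3)) (sym (^-assocʳ y 3 n)))

    -- The hypotheses make g₁ and g₂ the reciprocals of 1 - X and 1 + X³, and cubing is additive, so
    -- the factor is (1 + X)(1 - X)³ over (1 + X)³(1 - X). Nothing is cancelled here, where X is
    -- arbitrary; `quotient-dissection` cancels once for the whole product.
    factor-cubes : ∀ {X b₊ b₋ g₁ g₂} → b₊ ≈ 1# + X → b₋ ≈ 1# - X ^ 3 → g₁ ≈ 1# + X * g₁ → g₂ ≈ 1# - X ^ 3 * g₂ →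
      b₊ * (b₋ * (g₂ * g₁)) * ((1# + X) ^ 3 * (1# - X)) ≈ (1# + X) * (1# - X) ^ 3
    factor-cubes {X} {b₊} {b₋} {g₁} {g₂} b₊≈ b₋≈ g₁≈ g₂≈ = begin
      b₊ * (b₋ * (g₂ * g₁)) * ((1# + X) ^ 3 * (1# - X))
        ≈⟨ *-cong (*-cong b₊≈ (*-congʳ b₋≈)) (*-congʳ (cube-1+ X)) ⟩
      (1# + X) * ((1# - X ^ 3) * (g₂ * g₁)) * ((1# + X ^ 3) * (1# - X))
        ≈⟨ solve 6 (λ a b c d g₂ g₁ → a :* (b :* (g₂ :* g₁)) :* (c :* d) := a :* b :* ((c :* g₂) :* (d :* g₁))) refl
             (1# + X) (1# - X ^ 3) (1# + X ^ 3) (1# - X) g₂ g₁ ⟩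
      (1# + X) * (1# - X ^ 3) * ((1# + X ^ 3) * g₂ * ((1# - X) * g₁))
        ≈⟨ *-congˡ (*-cong inverse₂ inverse₁) ⟩
      (1# + X) * (1# - X ^ 3) * (1# * 1#)
        ≈⟨ solve 2 (λ a b → a :* b :* (con (+ 1) :* con (+ 1)) := a :* b) refl (1# + X) (1# - X ^ 3) ⟩
      (1# + X) * (1# - X ^ 3)                ≈⟨ *-congˡ (cube-1- X) ⟨
      (1# + X) * (1# - X) ^ 3                ∎
      where
      inverse₁ : (1# - X) * g₁ ≈ 1#
      inverse₁ = begin
        (1# - X) * g₁          ≈⟨ solve 2 (λ X g → (con (+ 1) :- X) :* g := g :- X :* g) refl X g₁ ⟩
        g₁ - X * g₁            ≈⟨ +-congʳ g₁≈ ⟩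
        1# + X * g₁ - X * g₁   ≈⟨ solve 2 (λ X g → con (+ 1) :+ X :* g :- X :* g := con (+ 1)) refl X g₁ ⟩
        1#                     ∎
      inverse₂ : (1# + X ^ 3) * g₂ ≈ 1#
      inverse₂ = begin
        (1# + X ^ 3) * g₂              ≈⟨ solve 2 (λ Y g → (con (+ 1) :+ Y) :* g := g :+ Y :* g) refl (X ^ 3) g₂ ⟩
        g₂ + X ^ 3 * g₂                ≈⟨ +-congʳ g₂≈ ⟩
        1# - X ^ 3 * g₂ + X ^ 3 * g₂   ≈⟨ solve 2 (λ Y g → con (+ 1) :- Y :* g :+ Y :* g := con (+ 1)) refl (X ^ 3) g₂ ⟩
        1#                             ∎

    ∏-cubes : ∀ n {f a b} → (∀ j → f j * (a j ^ 3 * b j) ≈ a j * b j ^ 3) → ∏ n f * (∏ n a ^ 3 * ∏ n b) ≈ ∏ n a * ∏ n b ^ 3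
    ∏-cubes zero    _ = solve 0 (con (+ 1) :* (con (+ 1) :^ 3 :* con (+ 1)) := con (+ 1) :* con (+ 1) :^ 3) refl
    ∏-cubes (suc n) {f} {a} {b} rel = begin
      ∏ n f * f n * ((∏ n a * a n) ^ 3 * (∏ n b * b n))
        ≈⟨ solve 6 (λ F A B f a b → F :* f :* ((A :* a) :^ 3 :* (B :* b)) := F :* (A :^ 3 :* B) :* (f :* (a :^ 3 :* b))) refl
             (∏ n f) (∏ n a) (∏ n b) (f n) (a n) (b n) ⟩
      ∏ n f * (∏ n a ^ 3 * ∏ n b) * (f n * (a n ^ 3 * b n))   ≈⟨ *-cong (∏-cubes n rel) (rel n) ⟩
      ∏ n a * ∏ n b ^ 3 * (a n * b n ^ 3)
        ≈⟨ solve 4 (λ A B a b → A :* B :^ 3 :* (a :* b :^ 3) := A :* a :* (B :* b) :^ 3) refl (∏ n a) (∏ n b) (a n) (b n) ⟩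
      ∏ n a * a n * (∏ n b * b n) ^ 3                         ∎

-- Subrings containing the theta products

module Subrings {c ℓ} (R : CommutativeRing c ℓ) where
  open CommutativeRing R
  open IntegerCoefficients R
  open FiniteProducts R
  open Exponentiation semiring using (_^_)

  -- Meant for the series in q^d. Closure under the ring operations passes from x to `Φ x`, `Ψ x`
  -- and `e`, so exponents modulo d are controlled without looking at coefficients.
  record IsSubring (S : Carrier → Set) : Set (c ⊔ ℓ) where
    field
      ∈-resp : ∀ {a b} → a ≈ b → S a → S b
      ∈-0    : S 0#
      ∈-1    : S 1#
      ∈-+    : ∀ {a b} → S a → S b → S (a + b)
      ∈-neg  : ∀ {a} → S a → S (- a)
      ∈-*    : ∀ {a b} → S a → S b → S (a * b)

    ∈-^ : ∀ {a} → S a → ∀ k → S (a ^ k)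
    ∈-^ sa zero    = ∈-1
    ∈-^ sa (suc k) = ∈-* sa (∈-^ sa k)

    ∈-∑ : ∀ n {f} → (∀ k → S (f k)) → S (∑ n f)
    ∈-∑ zero    sf = ∈-0
    ∈-∑ (suc n) sf = ∈-+ (∈-∑ n sf) (sf n)

    ∈-∏ : ∀ n {f} → (∀ k → S (f k)) → S (∏ n f)
    ∈-∏ zero    sf = ∈-1
    ∈-∏ (suc n) sf = ∈-* (∈-∏ n sf) (sf n)

    ∈-fromℕ : ∀ n → S (fromℕ n)
    ∈-fromℕ zero          = ∈-0
    ∈-fromℕ (suc zero)    = ∈-1
    ∈-fromℕ (suc (suc n)) = ∈-+ (∈-fromℕ (suc n)) ∈-1

    ∈-poch : ∀ n {z y} → S z → S y → S (poch n z y)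
    ∈-poch n sz sy = ∈-∏ n λ j → ∈-+ ∈-1 (∈-* sz (∈-^ sy j))

    module _ (N : ℕ) where
      open Nilpotent N

      ∈-Φ : ∀ {x} → S x → S (Φ x)
      ∈-Φ sx = ∈-* (∈-poch N (∈-neg sxx) sxx) (∈-* sA sA)
        where
        sxx = ∈-* sx sx
        sA  = ∈-poch N sx sxx

      ∈-Ψ : ∀ {x} → S x → S (Ψ x)
      ∈-Ψ sx = ∈-* (∈-poch N (∈-neg sxx) sxx) (∈-* sC sC)
        where
        sxx = ∈-* sx sx
        sC  = ∈-poch N sxx sxx

      ∈-e : ∀ {x} (nil : Nil x) → S x → ∀ k → S (e nil k)
      ∈-e nil sx zero    = ∈-1
      ∈-e nil sx (suc k) = ∈-* (∈-e nil sx k) (∈-∑ N (∈-^ (∈-^ (∈-* sx sx) (suc k))))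

-- Jacobi's identity and the dissection modulo 4

module ThetaQuotient {c ℓ} (R : CommutativeRing c ℓ) (N : ℕ) where
  open CommutativeRing R
  open IntegerCoefficients R
  open FiniteProducts R
  open Nilpotent N
  open GaussIdentities R N
  open Subrings R
  open CharacteristicThree R
  open Exponentiation semiring using (_^_; ^-congˡ; ^-assocʳ)
  open CommutativeExponentiation commutativeSemiring using (^-distrib-*)
  open SetoidReasoning setoid

  Φ-cong : ∀ {x y} → x ≈ y → Φ x ≈ Φ y
  Φ-cong x≈y = *-cong (poch-cong N (-‿cong xx) xx) (*-cong A≈ A≈)
    where
    xx = *-cong x≈y x≈y
    A≈ = poch-cong N x≈y xx

  Ψ-cong : ∀ {x y} → x ≈ y → Ψ x ≈ Ψ y
  Ψ-cong x≈y = *-cong (poch-cong N (-‿cong xx) xx) (*-cong C≈ C≈)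
    where
    xx = *-cong x≈y x≈y
    C≈ = poch-cong N xx xx

  2Ψ : Carrier → Carrier
  2Ψ x = Ψ x + Ψ x

  Φ-split-neg : ∀ {x} → Nil x → Φ (- x) ≈ Φ (x ^ 4) - x * 2Ψ (x ^ 4)
  Φ-split-neg {x} nil = begin
    Φ (- x)                                  ≈⟨ Φ-split (Nil-neg nil) ⟩
    Φ ((- x) ^ 4) + - x * 2Ψ ((- x) ^ 4)     ≈⟨ +-cong (Φ-cong x⁴) (*-congˡ (+-cong (Ψ-cong x⁴) (Ψ-cong x⁴))) ⟩
    Φ (x ^ 4) + - x * 2Ψ (x ^ 4)             ≈⟨ solve 3 (λ u x v → u :+ :- x :* v := u :- x :* v) refl _ x _ ⟩
    Φ (x ^ 4) - x * 2Ψ (x ^ 4)               ∎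
    where
    x⁴ : (- x) ^ 4 ≈ x ^ 4
    x⁴ = solve 1 (λ x → (:- x) :^ 4 := x :^ 4) refl x

  module _ {x : Carrier} (nil : Nil x) where

    private
      z = x * x
      t = x ^ 4
      nil-z : Nil z
      nil-z = Nil-* x nil
      nil-t : Nil t
      nil-t = Nil-^ nil 3

    -- Φ(± x) = u ± x v and Φ(± x²) = u₂ ± x² v₂.
    u v u₂ v₂ : Carrier
    u  = Φ t
    v  = 2Ψ t
    u₂ = Φ (z ^ 4)
    v₂ = 2Ψ (z ^ 4)

    -- The product of all 1 + t^k with k ≥ 1; by `ABC≈1` it is the reciprocal of `B t`, the product
    -- of the 1 - t^(2j+1).
    AC : Carrier
    AC = A t * C t

    inverse : Carrier
    inverse = e nil-t N * (AC * AC)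

    -- Φ(x) Φ(-x) = Φ(-x²)², with each Φ split by parity.
    norm-even : u * u + x ^ 2 * - (v * v) ≈ (u₂ * u₂ + x ^ 4 * (v₂ * v₂)) + x ^ 2 * - (u₂ * v₂ + u₂ * v₂)
    norm-even = begin
      u * u + x ^ 2 * - (v * v)
        ≈⟨ solve 3 (λ u v x → u :* u :+ x :^ 2 :* :- (v :* v) := (u :+ x :* v) :* (u :- x :* v)) refl u v x ⟩
      (u + x * v) * (u - x * v)        ≈⟨ *-cong (Φ-split nil) (Φ-split-neg nil) ⟨
      Φ x * Φ (- x)                    ≈⟨ Φ[x]Φ[-x] nil ⟩
      Φ (- z) * Φ (- z)                ≈⟨ *-cong (Φ-split-neg nil-z) (Φ-split-neg nil-z) ⟩
      (u₂ - z * v₂) * (u₂ - z * v₂)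
        ≈⟨ solve 3 (λ u v x → (u :- x :* x :* v) :* (u :- x :* x :* v)
             := (u :* u :+ x :^ 4 :* (v :* v)) :+ x :^ 2 :* :- (u :* v :+ u :* v)) refl u₂ v₂ x ⟩
      (u₂ * u₂ + x ^ 4 * (v₂ * v₂)) + x ^ 2 * - (u₂ * v₂ + u₂ * v₂) ∎

    inverse-Φ : Φ (- t) * inverse ≈ 1#
    inverse-Φ = begin
      Φ (- t) * inverse                                     ≈⟨ *-congʳ (Φ[-x] nil-t) ⟩
      D t * (B t * B t) * (e nil-t N * (AC * AC))
        ≈⟨ solve 5 (λ A B C D E → D :* (B :* B) :* (E :* (A :* C :* (A :* C))) := D :* E :* (A :* B :* C :* (A :* B :* C)))
             refl (A t) (B t) (C t) (D t) (e nil-t N) ⟩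
      D t * e nil-t N * (A t * B t * C t * (A t * B t * C t))  ≈⟨ *-cong (D-e nil-t ℕₚ.≤-refl) (*-cong (ABC≈1 nil-t) (ABC≈1 nil-t)) ⟩
      1# * (1# * 1#)                                        ≈⟨ solve 0 (con (+ 1) :* (con (+ 1) :* con (+ 1)) := con (+ 1)) refl ⟩
      1#                                                    ∎

    -- The numerator (u - x v)² (u² + x² v²) equals (u² + x² v²)² - 2 x u v (u² + x² v²). Divided by
    -- Φ(-t)⁴ and sorted by exponent, it gives `α` (multiples of 4), x² `β` (2 modulo 4) and x `γ`
    -- (odd). The twelfth power in `β` is written as a fourth power of a cube because cubes are what
    -- characteristic three simplifies.
    α β γ : Carrier
    α = inverse ^ 4 * (u ^ 4 + x ^ 4 * v ^ 4)
    β = fromℕ 8 * (AC ^ 3) ^ 4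
    γ = - (inverse ^ 4 * (fromℕ 2 * (u * v) * (u * u + x ^ 2 * (v * v))))

    -- Here u v is 2 D² AC² and the inverse of Φ(-t) is AC² / D, all at t. The powers of `D t`
    -- cancel and the constant is 2 · 2² = 8.
    β-product : inverse ^ 4 * (fromℕ 2 * ((u * v) * (u * v))) ≈ β
    β-product = begin
      inverse ^ 4 * (fromℕ 2 * ((u * v) * (u * v)))
        ≈⟨ *-congˡ (*-congˡ (*-cong uv uv)) ⟩
      inverse ^ 4 * (fromℕ 2 * (w * w))
        ≈⟨ solve 3 (λ D E K → (E :* (K :* K)) :^ 4 :* (con (+ 2) :* (con (+ 2) :* (D :* D :* (K :* K)) :* (con (+ 2) :* (D :* D :* (K :* K)))))
             := (D :* E) :^ 4 :* (con (+ 8) :* (K :^ 3) :^ 4)) refl (D t) (e nil-t N) AC ⟩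
      (D t * e nil-t N) ^ 4 * β      ≈⟨ *-congʳ (^-congˡ 4 (D-e nil-t ℕₚ.≤-refl)) ⟩
      1# ^ 4 * β                     ≈⟨ solve 1 (λ b → con (+ 1) :^ 4 :* b := b) refl β ⟩
      β                              ∎
      where
      w = fromℕ 2 * (D t * D t * (AC * AC))
      uv : u * v ≈ w
      uv = solve 3 (λ A C D → D :* (A :* A) :* (D :* (C :* C) :+ D :* (C :* C)) := con (+ 2) :* (D :* D :* (A :* C :* (A :* C))))
        refl (A t) (C t) (D t)

    -- The hypothesis is norm-even after x² ↦ -x², i.e. u² + x² v² = Φ(x²)².
    module _ (norm-flipped : u * u - x ^ 2 * - (v * v) ≈ (u₂ * u₂ + x ^ 4 * (v₂ * v₂)) - x ^ 2 * - (u₂ * v₂ + u₂ * v₂)) where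

      -- The left side is Φ(x) Φ(-x) Φ(x²)². Applying `Φ[x]Φ[-x]` at x turns it into the square of
      -- Φ(x²) Φ(-x²), and applying it at x² finishes.
      jacobi : (u + x * v) * (u - x * v) * (u * u + x ^ 2 * (v * v)) ≈ Φ (- t) ^ 4
      jacobi = begin
        (u + x * v) * (u - x * v) * (u * u + x ^ 2 * (v * v))
          ≈⟨ *-cong (*-cong (sym (Φ-split nil)) (sym (Φ-split-neg nil))) (begin
               u * u + x ^ 2 * (v * v)    ≈⟨ solve 3 (λ u v x → u :* u :+ x :^ 2 :* (v :* v) := u :* u :- x :^ 2 :* :- (v :* v)) refl u v x ⟩
               u * u - x ^ 2 * - (v * v)  ≈⟨ norm-flipped ⟩
               (u₂ * u₂ + x ^ 4 * (v₂ * v₂)) - x ^ 2 * - (u₂ * v₂ + u₂ * v₂)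
                 ≈⟨ solve 3 (λ u v x → (u :* u :+ x :^ 4 :* (v :* v)) :- x :^ 2 :* :- (u :* v :+ u :* v)
                      := (u :+ x :* x :* v) :* (u :+ x :* x :* v)) refl u₂ v₂ x ⟩
               (u₂ + z * v₂) * (u₂ + z * v₂) ≈⟨ *-cong (Φ-split nil-z) (Φ-split nil-z) ⟨
               Φ z * Φ z ∎) ⟩
        Φ x * Φ (- x) * (Φ z * Φ z)                      ≈⟨ *-congʳ (Φ[x]Φ[-x] nil) ⟩
        Φ (- z) * Φ (- z) * (Φ z * Φ z)
          ≈⟨ solve 2 (λ a b → a :* a :* (b :* b) := (b :* a) :* (b :* a)) refl (Φ (- z)) (Φ z) ⟩
        Φ z * Φ (- z) * (Φ z * Φ (- z))                  ≈⟨ *-cong (Φ[x]Φ[-x] nil-z) (Φ[x]Φ[-x] nil-z) ⟩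
        Φ (- (z * z)) * Φ (- (z * z)) * (Φ (- (z * z)) * Φ (- (z * z)))
          ≈⟨ solve 1 (λ a → a :* a :* (a :* a) := a :^ 4) refl (Φ (- (z * z))) ⟩
        Φ (- (z * z)) ^ 4                                ≈⟨ ^-congˡ 4 (Φ-cong (solve 1 (λ x → :- (x :* x :* (x :* x)) := :- (x :^ 4)) refl x)) ⟩
        Φ (- t) ^ 4                                      ∎

      -- Instead of dividing by Φ(x), P is multiplied by 1 = (Φ(-t) · `inverse`)⁴. By `jacobi` this
      -- contains the factor u + x v = Φ(x), on which P acts by `quotient`.
      quotient-dissection : ∀ {P} → P * (A x ^ 3 * B x) ≈ A x * B x ^ 3 → P ≈ α + x ^ 2 * β + x * γ
      quotient-dissection {P} cubes = begin
        P                                                        ≈⟨ *-identityʳ P ⟨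
        P * 1#                                                   ≈⟨ *-congˡ (solve 0 (con (+ 1) := con (+ 1) :^ 4) refl) ⟩
        P * 1# ^ 4                                               ≈⟨ *-congˡ (^-congˡ 4 inverse-Φ) ⟨
        P * (Φ (- t) * inverse) ^ 4                              ≈⟨ *-congˡ (^-distrib-* (Φ (- t)) inverse 4) ⟩
        P * (Φ (- t) ^ 4 * V)                                    ≈⟨ *-congˡ (*-congʳ jacobi) ⟨
        P * ((u + x * v) * (u - x * v) * (u * u + x ^ 2 * (v * v)) * V)
          ≈⟨ solve 5 (λ P a b c V → P :* (a :* b :* c :* V) := (P :* a) :* b :* c :* V) refl P (u + x * v) (u - x * v) (u * u + x ^ 2 * (v * v)) V ⟩
        P * (u + x * v) * (u - x * v) * (u * u + x ^ 2 * (v * v)) * V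
          ≈⟨ *-congʳ (*-congʳ (*-congʳ quotient)) ⟩
        (u - x * v) * (u - x * v) * (u * u + x ^ 2 * (v * v)) * V
          ≈⟨ solve 4 (λ u v x V → (u :- x :* v) :* (u :- x :* v) :* (u :* u :+ x :^ 2 :* (v :* v)) :* V
               := V :* (u :^ 4 :+ x :^ 4 :* v :^ 4) :+ x :^ 2 :* (V :* (con (+ 2) :* ((u :* v) :* (u :* v))))
                    :+ x :* :- (V :* (con (+ 2) :* (u :* v) :* (u :* u :+ x :^ 2 :* (v :* v))))) refl u v x V ⟩
        α + x ^ 2 * (V * (fromℕ 2 * ((u * v) * (u * v)))) + x * γ ≈⟨ +-congʳ (+-congˡ (*-congˡ β-product)) ⟩
        α + x ^ 2 * β + x * γ                                    ∎
        where
        V = inverse ^ 4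
        -- Since `A x * B x` has inverse `C x`, the surplus factor `A x * B x` on both sides of
        -- `cubes` can be removed.
        squares : P * (A x * A x) ≈ B x * B x
        squares = begin
          P * (A x * A x)                              ≈⟨ *-identityʳ _ ⟨
          P * (A x * A x) * 1#                         ≈⟨ *-congˡ (ABC≈1 nil) ⟨
          P * (A x * A x) * (A x * B x * C x)
            ≈⟨ solve 4 (λ P A B C → P :* (A :* A) :* (A :* B :* C) := P :* (A :^ 3 :* B) :* C) refl P (A x) (B x) (C x) ⟩
          P * (A x ^ 3 * B x) * C x                    ≈⟨ *-congʳ cubes ⟩
          A x * B x ^ 3 * C x
            ≈⟨ solve 3 (λ A B C → A :* B :^ 3 :* C := B :* B :* (A :* B :* C)) refl (A x) (B x) (C x) ⟩
          B x * B x * (A x * B x * C x)                ≈⟨ *-congˡ (ABC≈1 nil) ⟩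
          B x * B x * 1#                               ≈⟨ *-identityʳ _ ⟩
          B x * B x                                    ∎
        quotient : P * (u + x * v) ≈ u - x * v
        quotient = begin
          P * (u + x * v)             ≈⟨ *-congˡ (Φ-split nil) ⟨
          P * (D x * (A x * A x))     ≈⟨ solve 3 (λ P D a → P :* (D :* a) := D :* (P :* a)) refl P (D x) (A x * A x) ⟩
          D x * (P * (A x * A x))     ≈⟨ *-congˡ squares ⟩
          D x * (B x * B x)           ≈⟨ Φ[-x] nil ⟨
          Φ (- x)                     ≈⟨ Φ-split-neg nil ⟩
          u - x * v                   ∎

    record Dissection (S₂ S₄ S₁₂ : Carrier → Set) (P : Carrier) : Set (c ⊔ ℓ) where
      field
        {part₂ part₄ part₁₂} : Carrier
        part₂∈  : S₂ part₂
        part₄∈  : S₄ part₄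
        part₁₂∈ : S₁₂ part₁₂
        split   : P ≈ part₄ + x ^ 2 * part₁₂ + x * part₂

    module _ {S₂ S₄ S₁₂ : Carrier → Set}
             (subring₂ : IsSubring S₂) (subring₄ : IsSubring S₄) (subring₁₂ : IsSubring S₁₂)
             (x²∈S₂ : S₂ (x ^ 2)) (x⁴∈S₄ : S₄ (x ^ 4)) (x¹²∈S₁₂ : S₁₂ (x ^ 12))
             (S₄⊆S₂ : ∀ {a} → S₄ a → S₂ a)
             (flip-sign : ∀ {a a′ b b′} → S₄ a → S₄ a′ → S₄ b → S₄ b′ →
                a + x ^ 2 * b ≈ a′ + x ^ 2 * b′ → a - x ^ 2 * b ≈ a′ - x ^ 2 * b′)
             (3≈0 : fromℕ 3 ≈ 0#) where

      private
        module ∈₂  = IsSubring subring₂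
        module ∈₁₂ = IsSubring subring₁₂
        open IsSubring subring₄

        z⁴∈S₄ : S₄ (z ^ 4)
        z⁴∈S₄ = ∈-resp (solve 1 (λ x → x :^ 4 :* x :^ 4 := (x :* x) :^ 4) refl x) (∈-* x⁴∈S₄ x⁴∈S₄)

        2Ψ∈S₄ : ∀ {y} → S₄ y → S₄ (2Ψ y)
        2Ψ∈S₄ sy = ∈-+ (∈-Ψ N sy) (∈-Ψ N sy)

        u∈  = ∈-Φ N x⁴∈S₄
        v∈  = 2Ψ∈S₄ x⁴∈S₄
        u₂∈ = ∈-Φ N z⁴∈S₄
        v₂∈ = 2Ψ∈S₄ z⁴∈S₄

        inverse∈ : S₄ inverse
        inverse∈ = ∈-* (∈-e N nil-t x⁴∈S₄ N) (∈-* AC∈ AC∈)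
          where
          tt∈ = ∈-* x⁴∈S₄ x⁴∈S₄
          AC∈ = ∈-* (∈-poch N x⁴∈S₄ tt∈) (∈-poch N tt∈ tt∈)

        β∈ : S₁₂ β
        β∈ = ∈₁₂.∈-* (∈₁₂.∈-fromℕ 8) (∈₁₂.∈-^ (∈₁₂.∈-resp (sym (^-distrib-* (A t) (C t) 3))
          (∈₁₂.∈-* (cube t³∈ tt³∈) (cube tt³∈ tt³∈))) 4)
          where
          t³∈ : S₁₂ (t ^ 3)
          t³∈ = ∈₁₂.∈-resp (sym (^-assocʳ x 4 3)) x¹²∈S₁₂
          tt³∈ : S₁₂ ((t * t) ^ 3)
          tt³∈ = ∈₁₂.∈-resp (sym (^-distrib-* t t 3)) (∈₁₂.∈-* t³∈ t³∈)
          -- Cubing a product replaces both of its arguments by their cubes, so a product in t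
          -- becomes one in t³ = x¹².
          cube : ∀ {a b} → S₁₂ (a ^ 3) → S₁₂ (b ^ 3) → S₁₂ (poch N a b ^ 3)
          cube {a} {b} a∈ b∈ = ∈₁₂.∈-resp (sym (poch-cube 3≈0 N a b)) (∈₁₂.∈-poch N a∈ b∈)

        γ∈ : S₂ γ
        γ∈ = ∈₂.∈-neg (∈₂.∈-* (S₄⊆S₂ (∈-^ inverse∈ 4))
          (∈₂.∈-* (∈₂.∈-* (∈₂.∈-fromℕ 2) (S₄⊆S₂ (∈-* u∈ v∈)))
            (∈₂.∈-+ (S₄⊆S₂ (∈-* u∈ u∈)) (∈₂.∈-* x²∈S₂ (S₄⊆S₂ (∈-* v∈ v∈))))))

      dissection : ∀ {P} → P * (A x ^ 3 * B x) ≈ A x * B x ^ 3 → Dissection S₂ S₄ S₁₂ P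
      dissection cubes = record
        { part₂∈  = γ∈
        ; part₄∈  = ∈-* (∈-^ inverse∈ 4) (∈-+ (∈-^ u∈ 4) (∈-* x⁴∈S₄ (∈-^ v∈ 4)))
        ; part₁₂∈ = β∈
        ; split   = quotient-dissection norm-flipped cubes
        }
        where
        -- `norm-even` is arranged as a + x² b on both sides so that these four memberships in `S₄`
        -- make the change of sign legitimate.
        norm-flipped = flip-sign
          (∈-* u∈ u∈)
          (∈-+ (∈-* u₂∈ u₂∈) (∈-* x⁴∈S₄ (∈-* v₂∈ v₂∈)))
          (∈-neg (∈-* v∈ v∈))
          (∈-neg (∈-+ (∈-* u₂∈ v₂∈) (∈-* u₂∈ v₂∈)))
          norm-even

-- Power series modulo m and q^N

module SeriesAlgebra where
  open ≡ using (refl; sym; trans; cong; cong₂; subst; _≗_; module ≡-Reasoning)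
  open ≡-Reasoning

  infixl 6 _⊕_

  _⊕_ : Series → Series → Series
  (a ⊕ b) n = a n ℤ.+ b n

  neg : Series → Series
  neg a n = ℤ.- a n

  null : Series
  null _ = 0ℤ

  shift : Series → Series
  shift a n = a (suc n)

  sumTo-cong : ∀ n {f g} → (∀ k → k ≤ n → f k ≡ g k) → sumTo n f ≡ sumTo n g
  sumTo-cong zero    f≡g = f≡g 0 z≤n
  sumTo-cong (suc n) f≡g = cong₂ ℤ._+_ (sumTo-cong n (λ k k≤n → f≡g k (ℕₚ.m≤n⇒m≤1+n k≤n))) (f≡g (suc n) ℕₚ.≤-refl)

  sumTo-+ : ∀ n f g → sumTo n (λ k → f k ℤ.+ g k) ≡ sumTo n f ℤ.+ sumTo n g
  sumTo-+ zero    f g = refl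
  sumTo-+ (suc n) f g = trans (cong (ℤ._+ (f (suc n) ℤ.+ g (suc n))) (sumTo-+ n f g))
    (interchange (sumTo n f) (sumTo n g) (f (suc n)) (g (suc n)))
    where
    interchange : ∀ a b c d → (a ℤ.+ b) ℤ.+ (c ℤ.+ d) ≡ (a ℤ.+ c) ℤ.+ (b ℤ.+ d)
    interchange = ℤSolver.solve-∀

  sumTo-* : ∀ n c f → sumTo n (λ k → c ℤ.* f k) ≡ c ℤ.* sumTo n f
  sumTo-* zero    c f = refl
  sumTo-* (suc n) c f = trans (cong (ℤ._+ c ℤ.* f (suc n)) (sumTo-* n c f)) (sym (ℤₚ.*-distribˡ-+ c _ _))

  sumTo-head : ∀ n f → sumTo (suc n) f ≡ f 0 ℤ.+ sumTo n (f ∘ suc)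
  sumTo-head zero    f = refl
  sumTo-head (suc n) f = trans (cong (ℤ._+ f (suc (suc n))) (sumTo-head n f)) (ℤₚ.+-assoc (f 0) _ _)

  ⊛-head : ∀ a b n → (a ⊛ b) (suc n) ≡ a 0 ℤ.* b (suc n) ℤ.+ (shift a ⊛ b) n
  ⊛-head a b n = sumTo-head n (λ k → a k ℤ.* b (suc n ∸ k))

  ⊛-last : ∀ a b n → (a ⊛ b) (suc n) ≡ (a ⊛ shift b) n ℤ.+ a (suc n) ℤ.* b 0
  ⊛-last a b n = cong₂ ℤ._+_
    (sumTo-cong n (λ k k≤n → cong (λ i → a k ℤ.* b i) (ℕₚ.+-∸-assoc 1 k≤n)))
    (cong (λ i → a (suc n) ℤ.* b i) (ℕₚ.n∸n≡0 n))

  ⊛-congʳ : ∀ {a a′} b → a ≗ a′ → a ⊛ b ≗ a′ ⊛ b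
  ⊛-congʳ b a≗ n = sumTo-cong n (λ k _ → cong (ℤ._* b (n ∸ k)) (a≗ k))

  -- Taking the first term from one side and the last from the other replaces `a` by `shift a`, so
  -- the induction on the coefficient runs over all series at once.
  ⊛-comm : ∀ a b → a ⊛ b ≗ b ⊛ a
  ⊛-comm a b zero    = ℤₚ.*-comm (a 0) (b 0)
  ⊛-comm a b (suc n) = begin
    (a ⊛ b) (suc n)                               ≡⟨ ⊛-head a b n ⟩
    a 0 ℤ.* b (suc n) ℤ.+ (shift a ⊛ b) n          ≡⟨ ℤₚ.+-comm (a 0 ℤ.* b (suc n)) _ ⟩
    (shift a ⊛ b) n ℤ.+ a 0 ℤ.* b (suc n)          ≡⟨ cong₂ ℤ._+_ (⊛-comm (shift a) b n) (ℤₚ.*-comm (a 0) _) ⟩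
    (b ⊛ shift a) n ℤ.+ b (suc n) ℤ.* a 0          ≡⟨ ⊛-last b a n ⟨
    (b ⊛ a) (suc n)                               ∎

  ⊛-distribˡ : ∀ a b c → a ⊛ (b ⊕ c) ≗ (a ⊛ b) ⊕ (a ⊛ c)
  ⊛-distribˡ a b c n = trans
    (sumTo-cong n (λ k _ → ℤₚ.*-distribˡ-+ (a k) (b (n ∸ k)) (c (n ∸ k))))
    (sumTo-+ n (λ k → a k ℤ.* b (n ∸ k)) (λ k → a k ℤ.* c (n ∸ k)))

  ⊛-distribʳ : ∀ a b c → (b ⊕ c) ⊛ a ≗ (b ⊛ a) ⊕ (c ⊛ a)
  ⊛-distribʳ a b c n = trans (⊛-comm (b ⊕ c) a n) (trans (⊛-distribˡ a b c n) (cong₂ ℤ._+_ (⊛-comm a b n) (⊛-comm a c n)))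

  scale : ℤ → Series → Series
  scale c a n = c ℤ.* a n

  scale-⊛ : ∀ c a b → scale c a ⊛ b ≗ scale c (a ⊛ b)
  scale-⊛ c a b n = trans (sumTo-cong n (λ k _ → ℤₚ.*-assoc c (a k) (b (n ∸ k)))) (sumTo-* n c (λ k → a k ℤ.* b (n ∸ k)))

  ⊛-assoc : ∀ a b c → (a ⊛ b) ⊛ c ≗ a ⊛ (b ⊛ c)
  ⊛-assoc a b c zero    = ℤₚ.*-assoc (a 0) (b 0) (c 0)
  ⊛-assoc a b c (suc n) = begin
    ((a ⊛ b) ⊛ c) (suc n)
      ≡⟨ ⊛-head (a ⊛ b) c n ⟩
    a 0 ℤ.* b 0 ℤ.* c (suc n) ℤ.+ (shift (a ⊛ b) ⊛ c) n
      ≡⟨ cong (λ z → a 0 ℤ.* b 0 ℤ.* c (suc n) ℤ.+ z) (⊛-congʳ c (⊛-head a b) n) ⟩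
    a 0 ℤ.* b 0 ℤ.* c (suc n) ℤ.+ ((scale (a 0) (shift b) ⊕ (shift a ⊛ b)) ⊛ c) n
      ≡⟨ cong (λ z → a 0 ℤ.* b 0 ℤ.* c (suc n) ℤ.+ z) (⊛-distribʳ c (scale (a 0) (shift b)) (shift a ⊛ b) n) ⟩
    a 0 ℤ.* b 0 ℤ.* c (suc n) ℤ.+ ((scale (a 0) (shift b) ⊛ c) n ℤ.+ ((shift a ⊛ b) ⊛ c) n)
      ≡⟨ cong₂ (λ z w → a 0 ℤ.* b 0 ℤ.* c (suc n) ℤ.+ (z ℤ.+ w)) (scale-⊛ (a 0) (shift b) c n) (⊛-assoc (shift a) b c n) ⟩
    a 0 ℤ.* b 0 ℤ.* c (suc n) ℤ.+ (a 0 ℤ.* (shift b ⊛ c) n ℤ.+ (shift a ⊛ (b ⊛ c)) n)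
      ≡⟨ regroup (a 0) (b 0) (c (suc n)) ((shift b ⊛ c) n) _ ⟩
    a 0 ℤ.* (b 0 ℤ.* c (suc n) ℤ.+ (shift b ⊛ c) n) ℤ.+ (shift a ⊛ (b ⊛ c)) n
      ≡⟨ cong (λ z → a 0 ℤ.* z ℤ.+ (shift a ⊛ (b ⊛ c)) n) (⊛-head b c n) ⟨
    a 0 ℤ.* (b ⊛ c) (suc n) ℤ.+ (shift a ⊛ (b ⊛ c)) n
      ≡⟨ ⊛-head a (b ⊛ c) n ⟨
    (a ⊛ (b ⊛ c)) (suc n)  ∎
    where
    regroup : ∀ x y z w v → x ℤ.* y ℤ.* z ℤ.+ (x ℤ.* w ℤ.+ v) ≡ x ℤ.* (y ℤ.* z ℤ.+ w) ℤ.+ v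
    regroup = ℤSolver.solve-∀

  null-⊛ : ∀ a → null ⊛ a ≗ null
  null-⊛ a zero    = refl
  null-⊛ a (suc n) = trans (⊛-head null a n) (trans (ℤₚ.+-identityˡ _) (null-⊛ a n))

  one-⊛ : ∀ a → one ⊛ a ≗ a
  one-⊛ a zero    = ℤₚ.*-identityˡ (a 0)
  one-⊛ a (suc n) = begin
    (one ⊛ a) (suc n)                  ≡⟨ ⊛-head one a n ⟩
    1ℤ ℤ.* a (suc n) ℤ.+ (null ⊛ a) n  ≡⟨ cong₂ ℤ._+_ (ℤₚ.*-identityˡ (a (suc n))) (null-⊛ a n) ⟩
    a (suc n) ℤ.+ 0ℤ                   ≡⟨ ℤₚ.+-identityʳ _ ⟩
    a (suc n)                          ∎

  q : Series
  q (suc zero) = 1ℤ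
  q _          = 0ℤ

  q-⊛-suc : ∀ a n → (q ⊛ a) (suc n) ≡ a n
  q-⊛-suc a n = begin
    (q ⊛ a) (suc n)                        ≡⟨ ⊛-head q a n ⟩
    0ℤ ℤ.+ (shift q ⊛ a) n                  ≡⟨ ℤₚ.+-identityˡ _ ⟩
    (shift q ⊛ a) n                         ≡⟨ ⊛-congʳ a shift-q n ⟩
    (one ⊛ a) n                            ≡⟨ one-⊛ a n ⟩
    a n                                    ∎
    where
    shift-q : shift q ≗ one
    shift-q zero    = refl
    shift-q (suc n) = refl

  module _ (m : ℤ) (N : ℕ) where

    infix 4 _≋_

    record _≋_ (a b : Series) : Set where
      constructor congruent
      field
        coefficient : ∀ n → n < N → m ∣ₛ a n ℤ.- b n

    open _≋_ public

    ≗⇒≋ : ∀ {a b} → a ≗ b → a ≋ b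
    ≗⇒≋ {a} {b} a≗b = congruent (λ n _ → divides 0ℤ (ℤₚ.i≡j⇒i-j≡0 (a≗b n)))

    sumTo-∣ : ∀ n {f} → (∀ k → k ≤ n → m ∣ₛ f k) → m ∣ₛ sumTo n f
    sumTo-∣ zero    m∣f = m∣f 0 z≤n
    sumTo-∣ (suc n) m∣f = ∣m∣n⇒∣m+n (sumTo-∣ n (λ k k≤n → m∣f k (ℕₚ.m≤n⇒m≤1+n k≤n))) (m∣f (suc n) ℕₚ.≤-refl)

    ≋-trans : ∀ {a b c} → a ≋ b → b ≋ c → a ≋ c
    ≋-trans {a} {b} {c} a≋b b≋c = congruent λ n n<N →
      subst (m ∣ₛ_) (telescope (a n) (b n) (c n)) (∣m∣n⇒∣m+n (coefficient a≋b n n<N) (coefficient b≋c n n<N))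
      where
      telescope : ∀ x y z → (x ℤ.- y) ℤ.+ (y ℤ.- z) ≡ x ℤ.- z
      telescope = ℤSolver.solve-∀

    ≋-sym : ∀ {a b} → a ≋ b → b ≋ a
    ≋-sym {a} {b} a≋b = congruent λ n n<N → subst (m ∣ₛ_) (swap (a n) (b n)) (∣m⇒∣-m (coefficient a≋b n n<N))
      where
      swap : ∀ x y → ℤ.- (x ℤ.- y) ≡ y ℤ.- x
      swap = ℤSolver.solve-∀

    ⊕-≋ : ∀ {a a′ b b′} → a ≋ a′ → b ≋ b′ → a ⊕ b ≋ a′ ⊕ b′
    ⊕-≋ {a} {a′} {b} {b′} a≋ b≋ = congruent λ n n<N →
      subst (m ∣ₛ_) (rearrange (a n) (a′ n) (b n) (b′ n)) (∣m∣n⇒∣m+n (coefficient a≋ n n<N) (coefficient b≋ n n<N))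
      where
      rearrange : ∀ x x′ y y′ → (x ℤ.- x′) ℤ.+ (y ℤ.- y′) ≡ (x ℤ.+ y) ℤ.- (x′ ℤ.+ y′)
      rearrange = ℤSolver.solve-∀

    neg-≋ : ∀ {a b} → a ≋ b → neg a ≋ neg b
    neg-≋ {a} {b} a≋b = congruent λ n n<N → subst (m ∣ₛ_) (rearrange (a n) (b n)) (∣m⇒∣-m (coefficient a≋b n n<N))
      where
      rearrange : ∀ x y → ℤ.- (x ℤ.- y) ≡ ℤ.- x ℤ.- ℤ.- y
      rearrange = ℤSolver.solve-∀

    ⊛-≋ˡ : ∀ a {b b′} → b ≋ b′ → a ⊛ b ≋ a ⊛ b′
    ⊛-≋ˡ a {b} {b′} b≋ = congruent λ n n<N → subst (m ∣ₛ_) (difference n)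
      (sumTo-∣ n (λ k _ → ∣n⇒∣m*n (a k) (coefficient b≋ (n ∸ k) (ℕₚ.≤-<-trans (ℕₚ.m∸n≤m n k) n<N))))
      where
      split : ∀ x y z → x ℤ.* (y ℤ.- z) ≡ x ℤ.* y ℤ.+ -1ℤ ℤ.* (x ℤ.* z)
      split = ℤSolver.solve-∀
      difference : ∀ n → sumTo n (λ k → a k ℤ.* (b (n ∸ k) ℤ.- b′ (n ∸ k))) ≡ (a ⊛ b) n ℤ.- (a ⊛ b′) n
      difference n = begin
        sumTo n (λ k → a k ℤ.* (b (n ∸ k) ℤ.- b′ (n ∸ k)))
          ≡⟨ sumTo-cong n (λ k _ → split (a k) (b (n ∸ k)) (b′ (n ∸ k))) ⟩
        sumTo n (λ k → a k ℤ.* b (n ∸ k) ℤ.+ -1ℤ ℤ.* (a k ℤ.* b′ (n ∸ k)))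
          ≡⟨ sumTo-+ n _ _ ⟩
        (a ⊛ b) n ℤ.+ sumTo n (λ k → -1ℤ ℤ.* (a k ℤ.* b′ (n ∸ k)))
          ≡⟨ cong (λ z → (a ⊛ b) n ℤ.+ z) (trans (sumTo-* n -1ℤ _) (ℤₚ.-1*i≡-i _)) ⟩
        (a ⊛ b) n ℤ.- (a ⊛ b′) n ∎

    ⊛-≋ : ∀ {a a′ b b′} → a ≋ a′ → b ≋ b′ → a ⊛ b ≋ a′ ⊛ b′
    ⊛-≋ {a} {a′} {b} {b′} a≋ b≋ =
      ≋-trans (⊛-≋ˡ a b≋) (≋-trans (≗⇒≋ (⊛-comm a b′)) (≋-trans (⊛-≋ˡ b′ a≋) (≗⇒≋ (⊛-comm b′ a′))))

    -- The quotient of the series by the ideal (m, q^N). The carrier stays `Series`, so `factor` and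
    -- `partialProd` are elements of the ring as they stand.
    seriesRing : CommutativeRing _ _
    seriesRing = record
      { Carrier = Series
      ; _≈_ = _≋_
      ; _+_ = _⊕_
      ; _*_ = _⊛_
      ; -_ = neg
      ; 0# = null
      ; 1# = one
      ; isCommutativeRing = record
        { isRing = record
          { +-isAbelianGroup = record
            { isGroup = record
              { isMonoid = record
                { isSemigroup = record
                  { isMagma = record
                    { isEquivalence = record
                      { refl  = ≗⇒≋ (λ _ → refl)
                      ; sym   = ≋-sym
                      ; trans = ≋-trans
                      }
                    ; ∙-cong = ⊕-≋
                    }
                  ; assoc = λ a b c → ≗⇒≋ (λ n → ℤₚ.+-assoc (a n) (b n) (c n))
                  }
                ; identity = (λ a → ≗⇒≋ (λ n → ℤₚ.+-identityˡ (a n))) , (λ a → ≗⇒≋ (λ n → ℤₚ.+-identityʳ (a n)))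
                }
              ; inverse = (λ a → ≗⇒≋ (λ n → ℤₚ.+-inverseˡ (a n))) , (λ a → ≗⇒≋ (λ n → ℤₚ.+-inverseʳ (a n)))
              ; ⁻¹-cong = neg-≋
              }
            ; comm = λ a b → ≗⇒≋ (λ n → ℤₚ.+-comm (a n) (b n))
            }
          ; *-cong = ⊛-≋
          ; *-assoc = λ a b c → ≗⇒≋ (⊛-assoc a b c)
          ; *-identity = (λ a → ≗⇒≋ (one-⊛ a)) , (λ a → ≗⇒≋ (λ n → trans (⊛-comm a one n) (one-⊛ a n)))
          ; distrib = (λ a b c → ≗⇒≋ (⊛-distribˡ a b c)) , (λ a b c → ≗⇒≋ (⊛-distribʳ a b c))
          }
        ; *-comm = λ a b → ≗⇒≋ (⊛-comm a b)
        }
      }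

open SeriesAlgebra

module GeometricSeries (c : ℤ) (d : ℕ) where
  open ≡ using (trans; sym; cong)

  geom-∣ : ∀ n → n % suc d ≡ 0 → geom c d n ≡ c ℤ.^ (n / suc d)
  geom-∣ n n%d≡0 with n % suc d ℕ.≟ 0
  ... | yes _    = ≡.refl
  ... | no n%d≢0 = ⊥-elim (n%d≢0 n%d≡0)

  geom-∤ : ∀ n → n % suc d ≢ 0 → geom c d n ≡ 0ℤ
  geom-∤ n n%d≢0 with n % suc d ℕ.≟ 0
  ... | yes n%d≡0 = ⊥-elim (n%d≢0 n%d≡0)
  ... | no _      = ≡.refl

  residue : ∀ r → (suc d ℕ.+ r) % suc d ≡ r % suc d
  residue r = trans (cong (_% suc d) (ℕₚ.+-comm (suc d) r)) (DivMod.[m+n]%n≡m%n r (suc d))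

  geom-period : ∀ r → geom c d (suc d ℕ.+ r) ≡ c ℤ.* geom c d r
  geom-period r with r % suc d ℕ.≟ 0
  ... | yes r%d≡0 = trans (geom-∣ (suc d ℕ.+ r) (trans (residue r) r%d≡0)) (cong (c ℤ.^_) quotient)
    where
    quotient : (suc d ℕ.+ r) / suc d ≡ suc (r / suc d)
    quotient = trans (DivMod.m/n≡1+[m∸n]/n (ℕₚ.m≤m+n (suc d) r)) (cong (λ k → suc (k / suc d)) (ℕₚ.m+n∸m≡n (suc d) r))
  ... | no r%d≢0 = trans (geom-∤ (suc d ℕ.+ r) (r%d≢0 ∘ trans (sym (residue r)))) (sym (ℤₚ.*-zeroʳ c))

module SeriesModulo (m : ℤ) (N : ℕ) where
  open CommutativeRing (seriesRing m N) public
    using (_≈_; _+_; _*_; -_; _-_; 0#; 1#; +-cong; +-congˡ; +-congʳ; *-cong; *-congˡ; *-congʳ; -‿cong; setoid; semiring; commutativeSemiring;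
           *-identityˡ; *-identityʳ; *-assoc; *-comm; +-identityʳ; zeroˡ; zeroʳ)
    renaming (refl to ≈-refl; sym to ≈-sym; trans to ≈-trans)
  open IntegerCoefficients (seriesRing m N) public
  open Exponentiation semiring public using (_^_; ^-homo-*; ^-assocʳ; ^-congˡ; ^-congʳ)
  open CommutativeExponentiation commutativeSemiring public using (^-distrib-*)
  open FiniteProducts (seriesRing m N) public
  open Nilpotent N public
  open Subrings (seriesRing m N) public using (IsSubring)

  q^-⊛-shift : ∀ k a n → ((q ^ k) ⊛ a) (k ℕ.+ n) ≡ a n
  q^-⊛-shift zero    a n = one-⊛ a n
  q^-⊛-shift (suc k) a n = ≡.trans (⊛-assoc q (q ^ k) a (suc k ℕ.+ n))
    (≡.trans (q-⊛-suc ((q ^ k) ⊛ a) (k ℕ.+ n)) (q^-⊛-shift k a n))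

  q^-⊛-low : ∀ {k n} a → n < k → ((q ^ k) ⊛ a) n ≡ 0ℤ
  q^-⊛-low {suc k} {zero}  a _         = ⊛-assoc q (q ^ k) a 0
  q^-⊛-low {suc k} {suc n} a (s≤s n<k) = ≡.trans (⊛-assoc q (q ^ k) a (suc n))
    (≡.trans (q-⊛-suc ((q ^ k) ⊛ a) n) (q^-⊛-low a n<k))

  q^-⊛-one : ∀ k n → ((q ^ k) ⊛ one) n ≡ (q ^ k) n
  q^-⊛-one k n = ≡.trans (⊛-comm (q ^ k) one n) (one-⊛ (q ^ k) n)

  q^-coefficient : ∀ k → (q ^ k) k ≡ 1ℤ
  q^-coefficient k = ≡.trans (≡.sym (q^-⊛-one k k))
    (≡.trans (≡.cong ((q ^ k) ⊛ one) (≡.sym (ℕₚ.+-identityʳ k))) (q^-⊛-shift k one 0))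

  q^-coefficient-≢ : ∀ {k n} → n ≢ k → (q ^ k) n ≡ 0ℤ
  q^-coefficient-≢ {k} {n} n≢k with n ℕ.<? k
  ... | yes n<k = ≡.trans (≡.sym (q^-⊛-one k n)) (q^-⊛-low one n<k)
  ... | no n≮k with ℕₚ.m≤n⇒∃[o]m+o≡n (ℕₚ.≮⇒≥ n≮k)
  ...   | zero  , k+0≡n  = ⊥-elim (n≢k (≡.trans (≡.sym k+0≡n) (ℕₚ.+-identityʳ k)))
  ...   | suc o , ≡.refl = ≡.trans (≡.sym (q^-⊛-one k _)) (q^-⊛-shift k one (suc o))

  Nil-q : Nil q
  Nil-q = congruent λ n n<N → divides 0ℤ (ℤₚ.i≡j⇒i-j≡0 (q^-coefficient-≢ (ℕₚ.<⇒≢ n<N)))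

  binom-coefficient : ∀ c d n → binom c d n ≡ one n ℤ.+ c ℤ.* (q ^ suc d) n
  binom-coefficient c d zero = ≡.sym (≡.trans (≡.cong (λ z → 1ℤ ℤ.+ c ℤ.* z) (q^-coefficient-≢ {suc d} {0} λ ()))
    (≡.cong (λ z → 1ℤ ℤ.+ z) (ℤₚ.*-zeroʳ c)))
  binom-coefficient c d (suc n) with n ℕ.≟ d
  ... | yes ≡.refl = ≡.sym (≡.trans (ℤₚ.+-identityˡ _) (≡.trans (≡.cong (c ℤ.*_) (q^-coefficient (suc d))) (ℤₚ.*-identityʳ c)))
  ... | no n≢d     = ≡.sym (≡.trans (ℤₚ.+-identityˡ _)
    (≡.trans (≡.cong (c ℤ.*_) (q^-coefficient-≢ (n≢d ∘ ℕₚ.suc-injective))) (ℤₚ.*-zeroʳ c)))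

  -- The equation g = 1 + c q^(d+1) g, through which ring calculations treat `geom` as a reciprocal.
  -- Below q^(d+1) only the constant term is present; from there on the series repeats up to the
  -- factor c.
  geom-coefficient : ∀ c d n → geom c d n ≡ one n ℤ.+ c ℤ.* ((q ^ suc d) ⊛ geom c d) n
  geom-coefficient c d n with n ℕ.<? suc d
  ... | no n≮d with ℕₚ.m≤n⇒∃[o]m+o≡n (ℕₚ.≮⇒≥ n≮d)
  ...   | r , ≡.refl = ≡.trans (geom-period r)
    (≡.sym (≡.trans (ℤₚ.+-identityˡ _) (≡.cong (c ℤ.*_) (q^-⊛-shift (suc d) (geom c d) r))))
    where open GeometricSeries c d
  geom-coefficient c d n | yes n<d = ≡.trans (start n n<d)
    (≡.sym (≡.trans (≡.cong (λ z → one n ℤ.+ c ℤ.* z) (q^-⊛-low (geom c d) n<d))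
    (≡.trans (≡.cong (λ z → one n ℤ.+ z) (ℤₚ.*-zeroʳ c)) (ℤₚ.+-identityʳ (one n)))))
    where
    open GeometricSeries c d
    start : ∀ n → n < suc d → geom c d n ≡ one n
    start zero    _    = geom-∣ 0 ≡.refl
    start (suc n) n<d  = geom-∤ (suc n) λ n%d≡0 → ℕₚ.1+n≢0 (≡.trans (≡.sym (DivMod.m<n⇒m%n≡m n<d)) n%d≡0)

  binom-pos : ∀ d → binom 1ℤ d ≈ 1# + q ^ suc d
  binom-pos d = ≗⇒≋ m N λ n → ≡.trans (binom-coefficient 1ℤ d n) (≡.cong (λ z → one n ℤ.+ z) (ℤₚ.*-identityˡ _))

  binom-neg : ∀ d → binom -1ℤ d ≈ 1# - q ^ suc d
  binom-neg d = ≗⇒≋ m N λ n → ≡.trans (binom-coefficient -1ℤ d n) (≡.cong (λ z → one n ℤ.+ z) (ℤₚ.-1*i≡-i _))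

  geom-pos : ∀ d → geom 1ℤ d ≈ 1# + q ^ suc d * geom 1ℤ d
  geom-pos d = ≗⇒≋ m N λ n → ≡.trans (geom-coefficient 1ℤ d n) (≡.cong (λ z → one n ℤ.+ z) (ℤₚ.*-identityˡ _))

  geom-neg : ∀ d → geom -1ℤ d ≈ 1# - q ^ suc d * geom -1ℤ d
  geom-neg d = ≗⇒≋ m N λ n → ≡.trans (geom-coefficient -1ℤ d n) (≡.cong (λ z → one n ℤ.+ z) (ℤₚ.-1*i≡-i _))

  partialProd≈∏ : ∀ n → partialProd n ≈ ∏ n factor
  partialProd≈∏ zero    = ≈-refl
  partialProd≈∏ (suc n) = *-congʳ {factor n} (partialProd≈∏ n)

  -- Series in q^d. The coefficients are tested modulo `m` and below `N` only, which makes the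
  -- predicate invariant under `≈`.
  record Supported (d : ℕ) (a : Series) : Set where
    constructor supported
    field
      vanishes : ∀ n → n < N → ¬ d ℕ∣.∣ n → m ∣ₛ a n

  open Supported public

  Supported-≈ : ∀ {d a b} → a ≈ b → Supported d a → Supported d b
  Supported-≈ {d} {a} {b} a≈b sa = supported λ n n<N d∤n →
    ≡.subst (m ∣ₛ_) (cancel (a n) (b n)) (∣m∣n⇒∣m-n (vanishes sa n n<N d∤n) (coefficient a≈b n n<N))
    where
    cancel : ∀ x y → x ℤ.- (x ℤ.- y) ≡ y
    cancel = ℤSolver.solve-∀

  Supported-+ : ∀ {d a b} → Supported d a → Supported d b → Supported d (a + b)
  Supported-+ sa sb = supported λ n n<N d∤n → ∣m∣n⇒∣m+n (vanishes sa n n<N d∤n) (vanishes sb n n<N d∤n)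

  Supported-neg : ∀ {d a} → Supported d a → Supported d (- a)
  Supported-neg sa = supported λ n n<N d∤n → ∣m⇒∣-m (vanishes sa n n<N d∤n)

  Supported-0 : ∀ {d} → Supported d 0#
  Supported-0 = supported λ _ _ _ → divides 0ℤ ≡.refl

  Supported-1 : ∀ {d} → Supported d 1#
  Supported-1 = supported λ where
    zero    _ d∤0 → ⊥-elim (d∤0 (_ ℕ∣.∣0))
    (suc n) _ _   → divides 0ℤ ≡.refl

  Supported-* : ∀ {d a b} → Supported d a → Supported d b → Supported d (a * b)
  Supported-* {d} {a} {b} sa sb = supported λ n n<N d∤n → sumTo-∣ m N n (λ k k≤n → product n n<N d∤n k k≤n)
    where
    product : ∀ n → n < N → ¬ d ℕ∣.∣ n → ∀ k → k ≤ n → m ∣ₛ a k ℤ.* b (n ∸ k)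
    product n n<N d∤n k k≤n with d ℕ∣.∣? k
    ... | no d∤k  = ∣m⇒∣m*n (b (n ∸ k)) (vanishes sa k (ℕₚ.≤-<-trans k≤n n<N) d∤k)
    ... | yes d∣k = ∣n⇒∣m*n (a k) (vanishes sb (n ∸ k) (ℕₚ.≤-<-trans (ℕₚ.m∸n≤m n k) n<N)
      λ d∣n-k → d∤n (≡.subst (d ℕ∣.∣_) (ℕₚ.m+[n∸m]≡n k≤n) (ℕ∣.∣m∣n⇒∣m+n d∣k d∣n-k)))

  Supported-subring : ∀ d → IsSubring (Supported d)
  Supported-subring d = record
    { ∈-resp = Supported-≈
    ; ∈-0    = Supported-0
    ; ∈-1    = Supported-1
    ; ∈-+    = Supported-+
    ; ∈-neg  = Supported-neg
    ; ∈-*    = Supported-*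
    }

  Supported-∣ : ∀ {d d′ a} → d′ ℕ∣.∣ d → Supported d a → Supported d′ a
  Supported-∣ d′∣d sa = supported λ n n<N d′∤n → vanishes sa n n<N (d′∤n ∘ ℕ∣.∣-trans d′∣d)

  Supported-q^ : ∀ d → Supported d (q ^ d)
  Supported-q^ d = supported λ n n<N d∤n →
    divides 0ℤ (q^-coefficient-≢ λ n≡d → d∤n (ℕ∣.∣-reflexive (≡.sym n≡d)))

  -- The substitution q² ↦ -q² for series in q².
  flip-sign : ∀ {a a′ b b′} → Supported 4 a → Supported 4 a′ → Supported 4 b → Supported 4 b′ →
    a + q ^ 2 * b ≈ a′ + q ^ 2 * b′ → a - q ^ 2 * b ≈ a′ - q ^ 2 * b′
  flip-sign {a} {a′} {b} {b′} sa sa′ sb sb′ eq = congruent flipped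
    where
    twice : ∀ x x′ y y′ → ((x ℤ.+ y) ℤ.- (x′ ℤ.+ y′)) ℤ.- + 2 ℤ.* (y ℤ.- y′) ≡ (x ℤ.- y) ℤ.- (x′ ℤ.- y′)
    twice = ℤSolver.solve-∀
    twice′ : ∀ x x′ y y′ → + 2 ℤ.* (x ℤ.- x′) ℤ.- ((x ℤ.+ y) ℤ.- (x′ ℤ.+ y′)) ≡ (x ℤ.- y) ℤ.- (x′ ℤ.- y′)
    twice′ = ℤSolver.solve-∀
    q²-vanishes : ∀ {c} → Supported 4 c → ∀ n → n < N → 4 ℕ∣.∣ n → m ∣ₛ (q ^ 2 * c) n
    q²-vanishes {c} sc zero          _   _   = divides 0ℤ (q^-⊛-low {2} {0} c (s≤s z≤n))
    q²-vanishes {c} sc (suc zero)    _   _   = divides 0ℤ (q^-⊛-low {2} {1} c (s≤s (s≤s z≤n)))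
    q²-vanishes {c} sc (suc (suc n)) n<N 4∣n = ≡.subst (m ∣ₛ_) (≡.sym (q^-⊛-shift 2 c n))
      (vanishes sc n (ℕₚ.<-trans (ℕₚ.n<1+n n) (ℕₚ.<-trans (ℕₚ.n<1+n (suc n)) n<N))
        λ 4∣n′ → ℕ∣.>⇒∤ (s≤s (s≤s (s≤s z≤n))) (ℕ∣.∣m+n∣m⇒∣n (≡.subst (4 ℕ∣.∣_) (ℕₚ.+-comm 2 n) 4∣n) 4∣n′))
    flipped : ∀ n → n < N → m ∣ₛ (a - q ^ 2 * b) n ℤ.- (a′ - q ^ 2 * b′) n
    -- If 4 divides n, the q² terms vanish at n; otherwise `a` and `a′` do. In either case the
    -- wanted difference is the given one, up to sign, corrected by twice a quantity that vanishes.
    flipped n n<N with 4 ℕ∣.∣? n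
    ... | yes 4∣n = ≡.subst (m ∣ₛ_) (twice (a n) (a′ n) ((q ^ 2 * b) n) ((q ^ 2 * b′) n))
      (∣m∣n⇒∣m-n (coefficient eq n n<N)
        (∣n⇒∣m*n (+ 2) (∣m∣n⇒∣m-n (q²-vanishes sb n n<N 4∣n) (q²-vanishes sb′ n n<N 4∣n))))
    ... | no 4∤n = ≡.subst (m ∣ₛ_) (twice′ (a n) (a′ n) ((q ^ 2 * b) n) ((q ^ 2 * b′) n))
      (∣m∣n⇒∣m-n (∣n⇒∣m*n (+ 2) (∣m∣n⇒∣m-n (vanishes sa n n<N 4∤n) (vanishes sa′ n n<N 4∤n)))
        (coefficient eq n n<N))

-- The residue modulo 3

module Modulo3 (N : ℕ) where
  open SeriesModulo (+ 3) N
  open CharacteristicThree (seriesRing (+ 3) N)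
  open ThetaQuotient (seriesRing (+ 3) N) N

  3≈0 : fromℕ 3 ≈ 0#
  3≈0 = congruent λ where
    zero    _ → divides 1ℤ ≡.refl
    (suc n) _ → divides 0ℤ ≡.refl

  odd-power : ∀ j → q ^ suc (2 ℕ.* j) ≈ q * (q * q) ^ j
  odd-power j = *-congˡ {q} (≈-trans (≈-sym (^-assocʳ q 2 j)) (^-congˡ j (*-congˡ {q} (*-identityʳ q))))

  odd-power³ : ∀ j → q ^ suc (2 ℕ.+ 6 ℕ.* j) ≈ (q * (q * q) ^ j) ^ 3
  odd-power³ j = ≈-trans (^-congʳ q (exponent j)) (≈-trans (≈-sym (^-assocʳ q (suc (2 ℕ.* j)) 3)) (^-congˡ 3 (odd-power j)))
    where
    exponent : ∀ j → suc (2 ℕ.+ 6 ℕ.* j) ≡ suc (2 ℕ.* j) ℕ.* 3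
    exponent = ℕSolver.solve-∀

  factor-relation : ∀ j → let X = q * (q * q) ^ j in
    factor j * ((1# + X) ^ 3 * (1# - X)) ≈ (1# + X) * (1# - X) ^ 3
  factor-relation j = factor-cubes 3≈0
    (≈-trans (binom-pos (2 ℕ.* j)) (+-congˡ {1#} (odd-power j)))
    (≈-trans (binom-neg (2 ℕ.+ 6 ℕ.* j)) (+-congˡ {1#} (-‿cong (odd-power³ j))))
    (≈-trans (geom-pos (2 ℕ.* j)) (+-congˡ {1#} (*-congʳ {geom 1ℤ (2 ℕ.* j)} (odd-power j))))
    (≈-trans (geom-neg (2 ℕ.+ 6 ℕ.* j)) (+-congˡ {1#} (-‿cong (*-congʳ {geom -1ℤ (2 ℕ.+ 6 ℕ.* j)} (odd-power³ j)))))

  -- `partialProd N`, `A q` and `B q` all have exactly `N` factors, so the relation holds factor by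
  -- factor.
  partialProd-cubes : partialProd N * (A q ^ 3 * B q) ≈ A q * B q ^ 3
  partialProd-cubes = ≈-trans (*-cong (partialProd≈∏ N) (*-congˡ {A q ^ 3} B≈)) (≈-trans
    (∏-cubes 3≈0 N {factor} {λ j → 1# + q * (q * q) ^ j} {λ j → 1# - q * (q * q) ^ j} factor-relation)
    (*-congˡ {A q} (^-congˡ 3 (≈-sym B≈))))
    where
    B≈ : B q ≈ ∏ N (λ j → 1# - q * (q * q) ^ j)
    B≈ = ∏-cong N (λ j → +-congˡ {1#} (solve 2 (λ x t → :- x :* t := :- (x :* t)) ≈-refl q ((q * q) ^ j)))

  partialProd-dissection : Dissection Nil-q (Supported 2) (Supported 4) (Supported 12) (partialProd N)
  partialProd-dissection = dissection Nil-q
    (Supported-subring 2) (Supported-subring 4) (Supported-subring 12)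
    (Supported-q^ 2) (Supported-q^ 4) (Supported-q^ 12) (Supported-∣ (ℕ∣.divides 2 ≡.refl))
    flip-sign 3≈0 partialProd-cubes

  open Dissection partialProd-dissection

  -- Each of the three parts misses this exponent: 4 does not divide 6; after removing q² the
  -- exponent is 4 modulo 12, not 0; after removing q it is 5 modulo 12, hence odd.
  partialProd-12k+6 : ∀ k → 12 ℕ.* k ℕ.+ 6 < N → + 3 ∣ₛ partialProd N (12 ℕ.* k ℕ.+ 6)
  partialProd-12k+6 k n<N = ≡.subst (+ 3 ∣ₛ_) (cancel (partialProd N n) _)
    (∣m∣n⇒∣m+n (coefficient split n n<N)
      (∣m∣n⇒∣m+n (∣m∣n⇒∣m+n α-vanishes β-vanishes) γ-vanishes))
    where
    n = 12 ℕ.* k ℕ.+ 6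
    cancel : ∀ x y → (x ℤ.- y) ℤ.+ y ≡ x
    cancel = ℤSolver.solve-∀
    ∤ : ∀ {d} r → ¬ d ℕ∣.∣ r → d ℕ∣.∣ 12 → ¬ d ℕ∣.∣ 12 ℕ.* k ℕ.+ r
    ∤ r d∤r d∣12 d∣n = d∤r (ℕ∣.∣m+n∣m⇒∣n d∣n (ℕ∣.∣m⇒∣m*n k d∣12))
    swap : ∀ i j m → m ℕ.+ (i ℕ.+ j) ≡ i ℕ.+ (m ℕ.+ j)
    swap i j m = ≡.trans (≡.sym (ℕₚ.+-assoc m i j)) (≡.trans (≡.cong (ℕ._+ j) (ℕₚ.+-comm m i)) (ℕₚ.+-assoc i m j))
    below : ∀ i j → i ℕ.+ j ≡ 6 → 12 ℕ.* k ℕ.+ j < N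
    below i j i+j≡6 = ℕₚ.≤-<-trans (ℕₚ.+-monoʳ-≤ (12 ℕ.* k) (≡.subst (j ≤_) i+j≡6 (ℕₚ.m≤n+m j i))) n<N
    α-vanishes : + 3 ∣ₛ part₄ n
    α-vanishes = vanishes part₄∈ n n<N (∤ 6 (from-no (4 ℕ∣.∣? 6)) (ℕ∣.divides 3 ≡.refl))
    β-vanishes : + 3 ∣ₛ (q ^ 2 * part₁₂) n
    β-vanishes = ≡.subst (+ 3 ∣ₛ_)
      (≡.sym (≡.trans (≡.cong (q ^ 2 * part₁₂) (swap 2 4 (12 ℕ.* k))) (q^-⊛-shift 2 (part₁₂) (12 ℕ.* k ℕ.+ 4))))
      (vanishes part₁₂∈ (12 ℕ.* k ℕ.+ 4) (below 2 4 ≡.refl) (∤ 4 (from-no (12 ℕ∣.∣? 4)) ℕ∣.∣-refl))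
    γ-vanishes : + 3 ∣ₛ (q * part₂) n
    γ-vanishes = ≡.subst (+ 3 ∣ₛ_)
      (≡.sym (≡.trans (≡.cong (q * part₂) (swap 1 5 (12 ℕ.* k))) (q-⊛-suc (part₂) (12 ℕ.* k ℕ.+ 5))))
      (vanishes part₂∈ (12 ℕ.* k ℕ.+ 5) (below 1 5 ≡.refl) (∤ 5 (from-no (2 ℕ∣.∣? 5)) (ℕ∣.divides 6 ≡.refl)))

-- The residue modulo 4

module CharacteristicFour {c ℓ} (R : CommutativeRing c ℓ) where
  open CommutativeRing R
  open IntegerCoefficients R
  open FiniteProducts R
  open SetoidReasoning setoid

  module _ (4≈0 : fromℕ 4 ≈ 0#) where

    drop-4 : ∀ a b → a + fromℕ 4 * b ≈ a
    drop-4 a b = trans (+-congˡ (trans (*-congʳ 4≈0) (zeroˡ b))) (+-identityʳ a)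

    -- The recursions give (1 + X) g₁ = 2 g₁ - 1 and (1 - Y) g₂ = 2 g₂ - 1. Their product is 1 - 2
    -- (g₁ + g₂) + 4 g₁ g₂, and -2 = 2 modulo 4.
    factor-linear : ∀ {X Y b₊ b₋ g₁ g₂} → b₊ ≈ 1# + X → b₋ ≈ 1# - Y → g₁ ≈ 1# + X * g₁ → g₂ ≈ 1# - Y * g₂ →
      b₊ * (b₋ * (g₂ * g₁)) ≈ 1# + ((g₁ + g₂) + (g₁ + g₂))
    factor-linear {X} {Y} {b₊} {b₋} {g₁} {g₂} b₊≈ b₋≈ g₁≈ g₂≈ = begin
      b₊ * (b₋ * (g₂ * g₁))                      ≈⟨ *-cong b₊≈ (*-congʳ b₋≈) ⟩
      (1# + X) * ((1# - Y) * (g₂ * g₁))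
        ≈⟨ solve 4 (λ X Y g₁ g₂ → (con (+ 1) :+ X) :* ((con (+ 1) :- Y) :* (g₂ :* g₁))
             := (g₁ :+ (con (+ 1) :+ X :* g₁) :- con (+ 1)) :* (g₂ :+ (con (+ 1) :- Y :* g₂) :- con (+ 1))) refl X Y g₁ g₂ ⟩
      (g₁ + (1# + X * g₁) - 1#) * (g₂ + (1# - Y * g₂) - 1#)
        ≈⟨ *-cong (+-congʳ (+-congˡ g₁≈)) (+-congʳ (+-congˡ g₂≈)) ⟨
      (g₁ + g₁ - 1#) * (g₂ + g₂ - 1#)
        ≈⟨ solve 2 (λ a b → (a :+ a :- con (+ 1)) :* (b :+ b :- con (+ 1))
             := con (+ 1) :+ ((a :+ b) :+ (a :+ b)) :+ con (+ 4) :* (a :* b :- (a :+ b))) refl g₁ g₂ ⟩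
      1# + ((g₁ + g₂) + (g₁ + g₂)) + fromℕ 4 * (g₁ * g₂ - (g₁ + g₂))  ≈⟨ drop-4 _ _ ⟩
      1# + ((g₁ + g₂) + (g₁ + g₂))               ∎

    ∏-linear : ∀ n {f h} → (∀ j → f j ≈ 1# + (h j + h j)) → ∏ n f ≈ 1# + (∑ n h + ∑ n h)
    ∏-linear zero    _ = solve 0 (con (+ 1) := con (+ 1) :+ (con (+ 0) :+ con (+ 0))) refl
    ∏-linear (suc n) {f} {h} f≈ = begin
      ∏ n f * f n                                              ≈⟨ *-cong (∏-linear n f≈) (f≈ n) ⟩
      (1# + (∑ n h + ∑ n h)) * (1# + (h n + h n))
        ≈⟨ solve 2 (λ S h → (con (+ 1) :+ (S :+ S)) :* (con (+ 1) :+ (h :+ h))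
             := con (+ 1) :+ ((S :+ h) :+ (S :+ h)) :+ con (+ 4) :* (S :* h)) refl (∑ n h) (h n) ⟩
      1# + (∑ (suc n) h + ∑ (suc n) h) + fromℕ 4 * (∑ n h * h n) ≈⟨ drop-4 _ _ ⟩
      1# + (∑ (suc n) h + ∑ (suc n) h)                           ∎

-- Parity of the number of odd divisors

sumBelow : ℕ → (ℕ → ℕ) → ℕ
sumBelow zero    f = 0
sumBelow (suc n) f = sumBelow n f ℕ.+ f n

sumBelow-cong : ∀ n {f g} → (∀ k → f k ≡ g k) → sumBelow n f ≡ sumBelow n g
sumBelow-cong zero    f≡g = ≡.refl
sumBelow-cong (suc n) f≡g = ≡.cong₂ ℕ._+_ (sumBelow-cong n f≡g) (f≡g n)

sumBelow-+ : ∀ n f g → sumBelow n (λ k → f k ℕ.+ g k) ≡ sumBelow n f ℕ.+ sumBelow n g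
sumBelow-+ zero    f g = ≡.refl
sumBelow-+ (suc n) f g = ≡.trans (≡.cong (ℕ._+ (f n ℕ.+ g n)) (sumBelow-+ n f g))
  (interchange (sumBelow n f) (sumBelow n g) (f n) (g n))
  where
  interchange : ∀ a b c d → (a ℕ.+ b) ℕ.+ (c ℕ.+ d) ≡ (a ℕ.+ c) ℕ.+ (b ℕ.+ d)
  interchange = ℕSolver.solve-∀

sumBelow-zero : ∀ n {f} → (∀ k → k < n → f k ≡ 0) → sumBelow n f ≡ 0
sumBelow-zero zero    f≡0 = ≡.refl
sumBelow-zero (suc n) f≡0 = ≡.cong₂ ℕ._+_ (sumBelow-zero n (λ k k<n → f≡0 k (ℕₚ.m<n⇒m<1+n k<n))) (f≡0 n ℕₚ.≤-refl)

sumBelow-single : ∀ n {f i} → i < n → f i ≡ 1 → (∀ k → k ≢ i → f k ≡ 0) → sumBelow n f ≡ 1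
sumBelow-single (suc n) {f} {i} i<1+n fi≡1 f≡0 with i ℕ.≟ n
... | yes ≡.refl = ≡.cong₂ ℕ._+_ (sumBelow-zero n (λ k k<n → f≡0 k (ℕₚ.<⇒≢ k<n))) fi≡1
... | no i≢n     = ≡.cong₂ ℕ._+_ (sumBelow-single n (ℕₚ.≤∧≢⇒< (ℕₚ.≤-pred i<1+n) i≢n) fi≡1 f≡0) (f≡0 n (i≢n ∘ ≡.sym))

-- Bordering the table by a new row and column adds the same sum twice, and zero in the corner. This
-- replaces the pairing of a divisor with its cofactor by a plain induction.
symmetric-sum-even : ∀ n {f : ℕ → ℕ → ℕ} → (∀ j k → f j k ≡ f k j) → (∀ j → f j j ≡ 0) →
  2 ℕ∣.∣ sumBelow n (λ j → sumBelow n (f j))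
symmetric-sum-even zero    f-sym f-diag = 2 ℕ∣.∣0
symmetric-sum-even (suc n) {f} f-sym f-diag = ≡.subst (2 ℕ∣.∣_) (≡.sym expand)
  (ℕ∣.∣m∣n⇒∣m+n (symmetric-sum-even n f-sym f-diag) (ℕ∣.m∣m*n column))
  where
  column = sumBelow n (f n)
  block = sumBelow n (λ j → sumBelow n (f j))
  regroup : ∀ b c → b ℕ.+ c ℕ.+ (c ℕ.+ 0) ≡ b ℕ.+ 2 ℕ.* c
  regroup = ℕSolver.solve-∀
  expand : sumBelow (suc n) (λ j → sumBelow (suc n) (f j)) ≡ block ℕ.+ 2 ℕ.* column
  expand = ≡.trans (≡.cong₂ ℕ._+_
    (≡.trans (sumBelow-+ n (λ j → sumBelow n (f j)) (λ j → f j n)) (≡.cong (block ℕ.+_) (sumBelow-cong n (λ j → f-sym j n))))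
    (≡.cong (column ℕ.+_) (f-diag n)))
    (regroup block column)

indicator : ∀ {p} {P : Set p} → Dec P → ℕ
indicator (yes _) = 1
indicator (no _)  = 0

indicator-true : ∀ {p} {P : Set p} (P? : Dec P) → P → indicator P? ≡ 1
indicator-true (yes _) _ = ≡.refl
indicator-true (no ¬P) P = ⊥-elim (¬P P)

indicator-false : ∀ {p} {P : Set p} (P? : Dec P) → ¬ P → indicator P? ≡ 0
indicator-false (yes P) ¬P = ⊥-elim (¬P P)
indicator-false (no _)  _  = ≡.refl

indicator-⇔ : ∀ {p r} {P : Set p} {Q : Set r} (P? : Dec P) (Q? : Dec Q) → (P → Q) → (Q → P) → indicator P? ≡ indicator Q?
indicator-⇔ (yes P) Q? P⇒Q Q⇒P = ≡.sym (indicator-true Q? (P⇒Q P))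
indicator-⇔ (no ¬P) Q? P⇒Q Q⇒P = ≡.sym (indicator-false Q? (¬P ∘ Q⇒P))

even⊎odd : ∀ n → (∃ λ k → n ≡ 2 ℕ.* k) ⊎ (∃ λ k → n ≡ suc (2 ℕ.* k))
even⊎odd zero    = inj₁ (0 , ≡.refl)
even⊎odd (suc n) with even⊎odd n
... | inj₁ (k , n≡2k)   = inj₂ (k , ≡.cong suc n≡2k)
... | inj₂ (k , n≡2k+1) = inj₁ (suc k , ≡.trans (≡.cong suc n≡2k+1) (≡.cong suc (≡.sym (ℕₚ.+-suc k (k ℕ.+ 0)))))

odd-divisors : ℕ → ℕ → ℕ
odd-divisors N L = sumBelow N (λ j → indicator (suc (2 ℕ.* j) ℕ∣.∣? L))

-- Each odd divisor is recorded together with its cofactor, which is odd because L is. The table of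
-- pairs with product L is symmetric, and its diagonal is empty because L is not a square.
odd-divisors-even : ∀ {N L} → ¬ 2 ℕ∣.∣ L → (∀ m → L ≢ m ℕ.* m) → L < N → 2 ℕ∣.∣ odd-divisors N L
odd-divisors-even {N} {L} 2∤L nonsquare L<N = ≡.subst (2 ℕ∣.∣_) (≡.sym (sumBelow-cong N count))
  (symmetric-sum-even N pair-sym pair-diag)
  where
  odd : ℕ → ℕ
  odd j = suc (2 ℕ.* j)
  pair : ℕ → ℕ → ℕ
  pair j k = indicator (odd j ℕ.* odd k ℕ.≟ L)
  pair-sym : ∀ j k → pair j k ≡ pair k j
  pair-sym j k = indicator-⇔ (odd j ℕ.* odd k ℕ.≟ L) (odd k ℕ.* odd j ℕ.≟ L)
    (≡.trans (ℕₚ.*-comm (odd k) (odd j))) (≡.trans (ℕₚ.*-comm (odd j) (odd k)))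
  pair-diag : ∀ j → pair j j ≡ 0
  pair-diag j = indicator-false (odd j ℕ.* odd j ℕ.≟ L) (nonsquare (odd j) ∘ ≡.sym)
  odd-injective : ∀ {j k} → odd j ≡ odd k → j ≡ k
  odd-injective {j} {k} eq = ℕₚ.*-cancelˡ-≡ j k 2 (ℕₚ.suc-injective eq)
  count : ∀ j → indicator (odd j ℕ∣.∣? L) ≡ sumBelow N (pair j)
  count j with odd j ℕ∣.∣? L
  ... | no j∤L = ≡.sym (sumBelow-zero N λ k _ → indicator-false (odd j ℕ.* odd k ℕ.≟ L)
    λ eq → j∤L (ℕ∣.divides (odd k) (≡.trans (≡.sym eq) (ℕₚ.*-comm (odd j) (odd k)))))
  ... | yes (ℕ∣.divides c L≡c*j) with even⊎odd c
  ...   | inj₁ (k , ≡.refl) = ⊥-elim (2∤L (≡.subst (2 ℕ∣.∣_) (≡.sym L≡c*j) (ℕ∣.∣m⇒∣m*n (odd j) (ℕ∣.m∣m*n k))))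
  ...   | inj₂ (k , ≡.refl) = ≡.sym (sumBelow-single N k<N
    (indicator-true (odd j ℕ.* odd k ℕ.≟ L) jk≡L)
    λ k′ k′≢k → indicator-false (odd j ℕ.* odd k′ ℕ.≟ L)
      λ eq → k′≢k (odd-injective (ℕₚ.*-cancelˡ-≡ (odd k′) (odd k) (odd j) (≡.trans eq (≡.sym jk≡L)))))
    where
    jk≡L : odd j ℕ.* odd k ≡ L
    jk≡L = ≡.trans (ℕₚ.*-comm (odd j) (odd k)) (≡.sym L≡c*j)
    k<N : k < N
    k<N = ℕₚ.≤-<-trans (ℕₚ.≤-trans (ℕₚ.m≤m+n k (k ℕ.+ 0)) (ℕₚ.≤-trans (ℕₚ.n≤1+n _)
      (≡.subst (odd k ≤_) (≡.sym L≡c*j) (ℕₚ.m≤m*n (odd k) (odd j))))) L<N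

power-odd : ∀ {c} → + 2 ∣ₛ c ℤ.- 1ℤ → ∀ k → + 2 ∣ₛ c ℤ.^ k ℤ.- 1ℤ
power-odd         2∣c-1 zero    = divides 0ℤ ≡.refl
power-odd {c} 2∣c-1 (suc k) = ≡.subst (+ 2 ∣ₛ_) (split c (c ℤ.^ k))
  (∣m∣n⇒∣m+n (∣n⇒∣m*n c (power-odd 2∣c-1 k)) 2∣c-1)
  where
  split : ∀ c p → c ℤ.* (p ℤ.- 1ℤ) ℤ.+ (c ℤ.- 1ℤ) ≡ c ℤ.* p ℤ.- 1ℤ
  split = ℤSolver.solve-∀

-- Modulo 2 the sign c is invisible, so the series for 1/(1 - x) and for 1/(1 + x³) both simply
-- detect divisibility.
geom-parity : ∀ {c} d n → + 2 ∣ₛ c ℤ.- 1ℤ → + 2 ∣ₛ geom c d n ℤ.- + indicator (suc d ℕ∣.∣? n)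
geom-parity {c} d n 2∣c-1 with suc d ℕ∣.∣? n
... | yes d∣n = ≡.subst (λ g → + 2 ∣ₛ g ℤ.- 1ℤ) (≡.sym (geom-∣ n (ℕ∣.n∣m⇒m%n≡0 n (suc d) d∣n))) (power-odd 2∣c-1 (n / suc d))
  where open GeometricSeries c d
... | no d∤n  = ≡.subst (λ g → + 2 ∣ₛ g ℤ.- 0ℤ) (≡.sym (geom-∤ n (d∤n ∘ ℕ∣.m%n≡0⇒n∣m n (suc d)))) (divides 0ℤ ≡.refl)
  where open GeometricSeries c d

module Modulo4 (N : ℕ) where
  open SeriesModulo (+ 4) N
  open CharacteristicFour (seriesRing (+ 4) N)

  4≈0 : fromℕ 4 ≈ 0#
  4≈0 = congruent λ where
    zero    _ → divides 1ℤ ≡.refl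
    (suc n) _ → divides 0ℤ ≡.refl

  lambert : ℕ → Series
  lambert j = geom 1ℤ (2 ℕ.* j) + geom -1ℤ (2 ℕ.+ 6 ℕ.* j)

  partialProd-linear : partialProd N ≈ 1# + (∑ N lambert + ∑ N lambert)
  partialProd-linear = ≈-trans (partialProd≈∏ N) (∏-linear 4≈0 N {factor} {lambert} λ j → factor-linear 4≈0
    (binom-pos (2 ℕ.* j)) (binom-neg (2 ℕ.+ 6 ℕ.* j)) (geom-pos (2 ℕ.* j)) (geom-neg (2 ℕ.+ 6 ℕ.* j)))

  divisors : ℕ → ℕ → ℕ
  divisors M n = sumBelow M (λ j → indicator (suc (2 ℕ.* j) ℕ∣.∣? n) ℕ.+ indicator (suc (2 ℕ.+ 6 ℕ.* j) ℕ∣.∣? n))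

  lambert-parity : ∀ M n → + 2 ∣ₛ (∑ M lambert) n ℤ.- + divisors M n
  lambert-parity zero    n = divides 0ℤ ≡.refl
  lambert-parity (suc M) n = ≡.subst (+ 2 ∣ₛ_) (regroup ((∑ M lambert) n) (+ divisors M n) g₁ (+ i₁) g₂ (+ i₂))
    (∣m∣n⇒∣m+n (lambert-parity M n)
      (∣m∣n⇒∣m+n (geom-parity {c = 1ℤ} (2 ℕ.* M) n (divides 0ℤ ≡.refl)) (geom-parity {c = -1ℤ} (2 ℕ.+ 6 ℕ.* M) n (divides -1ℤ ≡.refl))))
    where
    g₁ = geom 1ℤ (2 ℕ.* M) n
    g₂ = geom -1ℤ (2 ℕ.+ 6 ℕ.* M) n
    i₁ = indicator (suc (2 ℕ.* M) ℕ∣.∣? n)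
    i₂ = indicator (suc (2 ℕ.+ 6 ℕ.* M) ℕ∣.∣? n)
    regroup : ∀ S D g i h j → (S ℤ.- D) ℤ.+ ((g ℤ.- i) ℤ.+ (h ℤ.- j)) ≡ (S ℤ.+ (g ℤ.+ h)) ℤ.- (D ℤ.+ (i ℤ.+ j))
    regroup = ℤSolver.solve-∀

  -- The index is a successor, so the constant term 1 of `partialProd-linear` does not contribute.
  partialProd-∣4 : ∀ n → suc n < N → 2 ℕ∣.∣ divisors N (suc n) → + 4 ∣ₛ partialProd N (suc n)
  partialProd-∣4 n n<N 2∣D = ≡.subst (+ 4 ∣ₛ_) (cancel (partialProd N (suc n)) Λ)
    (∣m∣n⇒∣m+n (coefficient partialProd-linear (suc n) n<N) (*-monoʳ-∣ (+ 2) 2∣Λ))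
    where
    Λ = (∑ N lambert) (suc n)
    cancel : ∀ x l → (x ℤ.- (0ℤ ℤ.+ (l ℤ.+ l))) ℤ.+ + 2 ℤ.* l ≡ x
    cancel = ℤSolver.solve-∀
    restore : ∀ l d → (l ℤ.- d) ℤ.+ d ≡ l
    restore = ℤSolver.solve-∀
    2∣Λ : + 2 ∣ₛ Λ
    2∣Λ = ≡.subst (+ 2 ∣ₛ_) (restore Λ (+ divisors N (suc n))) (∣m∣n⇒∣m+n (lambert-parity N (suc n)) (∣ᵤ⇒∣ 2∣D))

-- Divisibility by 12 and the arithmetic of the index

open import Data.Nat using (_+_; _*_; _^_)
open import Data.Integer.Divisibility using (_∣_)

odd∣2*⇒∣ : ∀ {d n} → ¬ 2 ℕ∣.∣ d → d ℕ∣.∣ 2 * n → d ℕ∣.∣ n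
odd∣2*⇒∣ {d} {n} 2∤d (ℕ∣.divides c 2n≡c*d) with euclidsLemma c d prime[2] (ℕ∣.divides n (≡.trans (≡.sym 2n≡c*d) (ℕₚ.*-comm 2 n)))
... | inj₂ 2∣d = ⊥-elim (2∤d 2∣d)
... | inj₁ (ℕ∣.divides c′ ≡.refl) = ℕ∣.divides c′ (ℕₚ.*-cancelˡ-≡ n (c′ * d) 2 (≡.trans 2n≡c*d (swap c′ d)))
  where
  swap : ∀ c d → c * 2 * d ≡ 2 * (c * d)
  swap = ℕSolver.solve-∀

2∤odd : ∀ j → ¬ 2 ℕ∣.∣ suc (2 * j)
2∤odd j 2∣odd = from-no (2 ℕ∣.∣? 1) (ℕ∣.∣m+n∣m⇒∣n (≡.subst (2 ℕ∣.∣_) (ℕₚ.+-comm 1 (2 * j)) 2∣odd) (ℕ∣.m∣m*n j))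

S3bar-6K-∣4 : ∀ k → let K = suc (2 * k) in (∀ m → K ≢ m * m) → (∀ m → 3 * K ≢ m * m) → + 4 ∣ S3bar (6 * K)
-- `S3bar (6 * K)` unfolds to `partialProd N (6 * K)` with `N = suc (6 * K)`, so the truncation at
-- q^N just keeps the coefficient in question.
S3bar-6K-∣4 k K≢□ 3K≢□ = ∣⇒∣ᵤ (partialProd-∣4 _ ℕₚ.≤-refl
  (≡.subst (2 ℕ∣.∣_) (≡.sym split) (ℕ∣.∣m∣n⇒∣m+n
    (odd-divisors-even 2∤3K 3K≢□ (s≤s (ℕₚ.*-monoˡ-≤ K (from-yes (3 ℕ.≤? 6)))))
    (odd-divisors-even (2∤odd k) K≢□ (s≤s (ℕₚ.m≤n*m K 6))))))
  where
  K = suc (2 * k)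
  N = suc (6 * K)
  open Modulo4 N
  2∤3K : ¬ 2 ℕ∣.∣ 3 * K
  2∤3K 2∣3K = [ from-no (2 ℕ∣.∣? 3) , 2∤odd k ]′ (euclidsLemma 3 K prime[2] 2∣3K)
  first : ∀ j → indicator (suc (2 * j) ℕ∣.∣? 6 * K) ≡ indicator (suc (2 * j) ℕ∣.∣? 3 * K)
  first j = indicator-⇔ (suc (2 * j) ℕ∣.∣? 6 * K) (suc (2 * j) ℕ∣.∣? 3 * K)
    (odd∣2*⇒∣ (2∤odd j) ∘ ≡.subst (suc (2 * j) ℕ∣.∣_) (ℕₚ.*-assoc 2 3 K))
    (≡.subst (suc (2 * j) ℕ∣.∣_) (≡.sym (ℕₚ.*-assoc 2 3 K)) ∘ ℕ∣.∣n⇒∣m*n 2)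
  3*odd : ∀ j → suc (2 + 6 * j) ≡ 3 * suc (2 * j)
  3*odd = ℕSolver.solve-∀
  second : ∀ j → indicator (suc (2 + 6 * j) ℕ∣.∣? 6 * K) ≡ indicator (suc (2 * j) ℕ∣.∣? K)
  second j = indicator-⇔ (suc (2 + 6 * j) ℕ∣.∣? 6 * K) (suc (2 * j) ℕ∣.∣? K)
    (λ d∣ → odd∣2*⇒∣ (2∤odd j) (ℕ∣.*-cancelˡ-∣ 3 (≡.subst₂ ℕ∣._∣_ (3*odd j) (ℕₚ.*-assoc 3 2 K) d∣)))
    (λ d∣ → ≡.subst₂ ℕ∣._∣_ (≡.sym (3*odd j)) (≡.sym (ℕₚ.*-assoc 3 2 K)) (ℕ∣.*-monoʳ-∣ 3 (ℕ∣.∣n⇒∣m*n 2 d∣)))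
  split : divisors N (6 * K) ≡ odd-divisors N (3 * K) + odd-divisors N K
  split = ≡.trans (sumBelow-cong N (λ j → ≡.cong₂ _+_ (first j) (second j)))
    (sumBelow-+ N (λ j → indicator (suc (2 * j) ℕ∣.∣? 3 * K)) (λ j → indicator (suc (2 * j) ℕ∣.∣? K)))

S3bar-6K-∣3 : ∀ k → + 3 ∣ S3bar (6 * suc (2 * k))
S3bar-6K-∣3 k = ≡.subst (λ n → + 3 ∣ S3bar n) (index k) (∣⇒∣ᵤ (Modulo3.partialProd-12k+6 (suc (12 * k + 6)) k ℕₚ.≤-refl))
  where
  index : ∀ k → 12 * k + 6 ≡ 6 * suc (2 * k)
  index = ℕSolver.solve-∀

3∣4∣⇒12∣ : ∀ {n} → 3 ℕ∣.∣ n → 4 ℕ∣.∣ n → 12 ℕ∣.∣ n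
3∣4∣⇒12∣ 3∣n (ℕ∣.divides c ≡.refl) with euclidsLemma c 4 (from-yes (prime? 3)) 3∣n
... | inj₁ 3∣c = ℕ∣.*-monoˡ-∣ 4 3∣c
... | inj₂ 3∣4 = ⊥-elim (from-no (3 ℕ∣.∣? 4) 3∣4)

∣²⇒∣ : ∀ {p} m → Prime p → p ℕ∣.∣ m * m → p ℕ∣.∣ m
∣²⇒∣ m p-prime p∣m² = [ id , id ]′ (euclidsLemma m m p-prime p∣m²)

-- Descent: p divides m, so p² cancels and the exponent drops by 2. At exponent 1 one factor p is
-- left over and would have to divide M.
odd-power-nonsquare : ∀ {p M} → Prime p → ¬ p ℕ∣.∣ M → ∀ α m → p ^ (2 * α + 1) * M ≢ m * m
odd-power-nonsquare {p} {M} p-prime p∤M α m pM≡m² with ∣²⇒∣ m p-prime (≡.subst (p ℕ∣.∣_) pM≡m²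
  (ℕ∣.∣m⇒∣m*n M (≡.subst (λ e → p ℕ∣.∣ p ^ e) (ℕₚ.+-comm 1 (2 * α)) (ℕ∣.m∣m*n (p ^ (2 * α))))))
odd-power-nonsquare {p} {M} p-prime p∤M zero    m pM≡m² | ℕ∣.divides k ≡.refl =
  p∤M (ℕ∣.divides (k * k) (ℕₚ.*-cancelˡ-≡ M (k * k * p) p (≡.trans (≡.sym (left p M)) (≡.trans pM≡m² (right k p)))))
  where
  instance _ = prime⇒nonZero p-prime
  left : ∀ p M → p ^ 1 * M ≡ p * M
  left p M = ≡.cong (_* M) (ℕₚ.*-identityʳ p)
  right : ∀ k p → k * p * (k * p) ≡ p * (k * k * p)
  right = ℕSolver.solve-∀
odd-power-nonsquare {p} {M} p-prime p∤M (suc α) m pM≡m² | ℕ∣.divides k ≡.refl =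
  odd-power-nonsquare p-prime p∤M α k (ℕₚ.*-cancelˡ-≡ _ _ p (ℕₚ.*-cancelˡ-≡ _ _ p
    (≡.trans (≡.sym left) (≡.trans pM≡m² (right k p)))))
  where
  instance _ = prime⇒nonZero p-prime
  exponent : ∀ α → 2 * suc α + 1 ≡ suc (suc (2 * α + 1))
  exponent = ℕSolver.solve-∀
  assoc : ∀ p x M → p * (p * x) * M ≡ p * (p * (x * M))
  assoc = ℕSolver.solve-∀
  left : p ^ (2 * suc α + 1) * M ≡ p * (p * (p ^ (2 * α + 1) * M))
  left = ≡.trans (≡.cong (λ e → p ^ e * M) (exponent α)) (assoc p (p ^ (2 * α + 1)) M)
  right : ∀ k p → k * p * (k * p) ≡ p * (p * (k * k))
  right = ℕSolver.solve-∀

prime∣^⇒∣ : ∀ {r p} → Prime r → ∀ e → r ℕ∣.∣ p ^ suc e → r ℕ∣.∣ p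
prime∣^⇒∣ {r} {p} r-prime zero    r∣p^1 = ≡.subst (r ℕ∣.∣_) (ℕₚ.*-identityʳ p) r∣p^1
prime∣^⇒∣ {r} {p} r-prime (suc e) r∣p^e = [ id , prime∣^⇒∣ r-prime e ]′ (euclidsLemma p (p ^ suc e) r-prime r∣p^e)

theorem4p8 : (p : ℕ) → Prime p → p % 6 ≡ 5 → LegendreMinus3IsMinus1 p →
    (α n i : ℕ) → 1 ≤ i → i ≤ p ∸ 1 →
    + 12 ∣ S3bar (36 * p ^ (2 * α + 2) * n + 6 * (6 * i + p) * p ^ (2 * α + 1))
theorem4p8 p p-prime p%6≡5 _ α n i 1≤i i≤p-1 = ≡.subst (λ m → + 12 ∣ S3bar m) (≡.sym index) 12∣
  where
  instance _ = prime⇒nonZero p-prime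
  -- What remains of the index after the factor 6 p^(2α+1) is removed. It is odd because p is, and
  -- prime to p because p divides neither 6 nor i.
  M = 6 * (p * n + i) + p
  K = p ^ (2 * α + 1) * M

  index : 36 * p ^ (2 * α + 2) * n + 6 * (6 * i + p) * p ^ (2 * α + 1) ≡ 6 * K
  index = ≡.trans (≡.cong (λ e → 36 * p ^ e * n + 6 * (6 * i + p) * p ^ (2 * α + 1)) (ℕₚ.+-suc (2 * α) 1))
    (collect p (p ^ (2 * α + 1)) n i)
    where
    collect : ∀ p x n i → 36 * (p * x) * n + 6 * (6 * i + p) * x ≡ 6 * (x * (6 * (p * n + i) + p))
    collect = ℕSolver.solve-∀

  p≡ : p ≡ 5 + p / 6 * 6
  p≡ = ≡.trans (DivMod.m≡m%n+[m/n]*n p 6) (≡.cong (_+ p / 6 * 6) p%6≡5)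

  ∤p : ∀ {r} → r ℕ∣.∣ 6 → ¬ r ℕ∣.∣ 5 → ¬ r ℕ∣.∣ p
  ∤p r∣6 r∤5 r∣p = r∤5 (ℕ∣.∣m+n∣m⇒∣n (≡.subst (_ ℕ∣.∣_) (≡.trans p≡ (ℕₚ.+-comm 5 (p / 6 * 6))) r∣p)
    (ℕ∣.∣n⇒∣m*n (p / 6) r∣6))

  2∤p : ¬ 2 ℕ∣.∣ p
  2∤p = ∤p (ℕ∣.divides 3 ≡.refl) (from-no (2 ℕ∣.∣? 5))

  p∤6 : ¬ p ℕ∣.∣ 6
  p∤6 p∣6 = [ p∤prime prime[2] (ℕ∣.divides 3 ≡.refl) (from-no (2 ℕ∣.∣? 5))
            , p∤prime (from-yes (prime? 3)) (ℕ∣.divides 2 ≡.refl) (from-no (3 ℕ∣.∣? 5)) ]′ (euclidsLemma 2 3 p-prime p∣6)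
    where
    p∤prime : ∀ {r} → Prime r → r ℕ∣.∣ 6 → ¬ r ℕ∣.∣ 5 → ¬ p ℕ∣.∣ r
    p∤prime {r} r-prime r∣6 r∤5 p∣r with prime⇒irreducible r-prime p∣r
    ... | inj₁ p≡1 = ¬prime[1] (≡.subst Prime p≡1 p-prime)
    ... | inj₂ p≡r = ∤p r∣6 r∤5 (ℕ∣.∣-reflexive (≡.sym p≡r))

  p∤i : ¬ p ℕ∣.∣ i
  p∤i = ℕ∣.>⇒∤ {{ℕ.>-nonZero 1≤i}} (ℕₚ.≤-trans (s≤s i≤p-1) (ℕₚ.≤-reflexive (ℕₚ.suc-pred p)))

  p∤M : ¬ p ℕ∣.∣ M
  p∤M p∣M = [ p∤6 , (λ p∣pn+i → p∤i (ℕ∣.∣m+n∣m⇒∣n p∣pn+i (ℕ∣.m∣m*n n))) ]′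
    (euclidsLemma 6 (p * n + i) p-prime (ℕ∣.∣m+n∣m⇒∣n (≡.subst (p ℕ∣.∣_) (ℕₚ.+-comm _ p) p∣M) ℕ∣.∣-refl))

  p∤3M : ¬ p ℕ∣.∣ 3 * M
  p∤3M p∣3M = [ (λ p∣3 → p∤6 (ℕ∣.∣m⇒∣m*n 2 p∣3)) , p∤M ]′ (euclidsLemma 3 M p-prime p∣3M)

  2∤K : ¬ 2 ℕ∣.∣ K
  2∤K 2∣K = [ (λ 2∣p^ → 2∤p (prime∣^⇒∣ prime[2] (2 * α) (≡.subst (λ e → 2 ℕ∣.∣ p ^ e) (ℕₚ.+-comm (2 * α) 1) 2∣p^)))
            , (λ 2∣M → 2∤p (ℕ∣.∣m+n∣m⇒∣n 2∣M (ℕ∣.∣m⇒∣m*n (p * n + i) (ℕ∣.divides 3 ≡.refl)))) ]′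
    (euclidsLemma (p ^ (2 * α + 1)) M prime[2] 2∣K)

  3K≢□ : ∀ m → 3 * K ≢ m * m
  3K≢□ m 3K≡m² = odd-power-nonsquare p-prime p∤3M α m (≡.trans (swap (p ^ (2 * α + 1)) M) 3K≡m²)
    where
    swap : ∀ x M → x * (3 * M) ≡ 3 * (x * M)
    swap = ℕSolver.solve-∀

  12∣ : + 12 ∣ S3bar (6 * K)
  12∣ = [ (λ (k , K≡2k) → ⊥-elim (2∤K (≡.subst (2 ℕ∣.∣_) (≡.sym K≡2k) (ℕ∣.m∣m*n k)))) , odd ]′ (even⊎odd K)
    where
    odd : (∃ λ k → K ≡ suc (2 * k)) → + 12 ∣ S3bar (6 * K)
    odd (k , K≡2k+1) = ≡.subst (λ K → + 12 ∣ S3bar (6 * K)) (≡.sym K≡2k+1)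
      (3∣4∣⇒12∣ (S3bar-6K-∣3 k)
        (S3bar-6K-∣4 k (λ m → odd-power-nonsquare p-prime p∤M α m ∘ ≡.trans K≡2k+1)
                       (λ m → 3K≢□ m ∘ ≡.trans (≡.cong (3 *_) K≡2k+1))))
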